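{- Let $F$ be a genus $0$ fatgraph and $L\subset S^3$ its associated link, with an arbitrary orientation. Then for all $i,j$, \[ H^i_j(\widetilde{\mathcal C}(F))\cong\bigoplus_{p+q+r=j}\Big(\Big(\big(\widetilde{HK}^i_p(L)\otimes\overline\Delta(R^{\otimes(i-1)})_q\big)\oplus\big(Z^i_p(L)\otimes R^{\otimes i}_q/\overline\Delta(R^{\otimes(i-1)})_q\big)\Big)\otimes (V^{\otimes v(F)})_r\Big), \] where $M_p$ denotes the degree-$p$ part of a graded module $M$, $\overline\Delta=\overline\Delta_{i-1}$, $\widetilde{HK}(L)$ is the homology of the unnormalized Khovanov complex $\widetilde{\mathcal C}(L)$ and $Z^i_p(L)=\ker(\widetilde d^i)_p$ are its cycles. Moreover $H^i_j(\mathcal C(F))=H^{i+e(F)}_j(\widetilde{\mathcal C}(F))$.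
   Context: A fatgraph is a finite graph (loops and multiple edges allowed) with a cyclic order of half-edges at each vertex; it determines a compact orientable surface with boundary; genus $0$ means it comes from an embedding in the sphere. For a fatgraph $H$: $v(H),e(H)$ numbers of vertices and edges, $p(H)$ boundary components, $g(H)$ genus. A state is a spanning fatsubgraph $H=(V(F),W)$, $W\subseteq E(F)$, of height $h(H)=e(F)-e(H)$. $M\{l\}_m=M_{m-l}$; $(\mathcal C[s])^i=\mathcal C^{i-s}$. Modules and maps: $V$ free graded $\mathbb Z$-module on $v_\pm$ in degrees $\pm1$; $R$ free on $x_{ -2},x_0$ in degrees $-2,0$. $\widetilde m':V\otimes V\to V$, $v_+\otimes v_+\mapsto v_+$, $v_\pm\otimes v_\mp\mapsto v_-$, $v_-\otimes v_-\mapsto0$; $\widetilde\Delta':V\to V\otimes V$, $v_+\mapsto v_+\otimes v_-+v_-\otimes v_+$, $v_-\mapsto v_-\otimes v_-$; $\overline\Delta_h:R^{\otimes h}\to R^{\otimes(h+1)}$ is $1\mapsto x_0$ for $h=0$ and for $h\ge1$ acts on the last factor by $x_0\mapsto x_0\otimes x_0$, $x_{ -2}\mapsto x_{ -2}\otimes x_0+x_0\otimes x_{ -2}$. Number edges $1,\dots,n$, encode states by $\alpha\in\{0,1\}^n$ ($\alpha_i=0$ iff edge $i$ present); for edge $j\in H$, deleting it either merges two boundary components of $H$ or splits one (for genus $0$ the genus stays $0$). Chromatic complex (genus 0): state $H$ gets $A(H)=V^{\otimes v(H)}\otimes V^{\otimes p(H)}\otimes R^{\otimes h(H)}\{h(H)\}$;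 the per-edge map $A(H)\to A(H-e_j)$ is $(-1)^{\sum_{i<j}\alpha_i}$ times (identity on $V^{\otimes v}$)$\otimes$($\widetilde m'$ on merging boundary factors or $\widetilde\Delta'$ on a splitting factor, identity elsewhere)$\otimes\overline\Delta_{h(H)}$; $\widetilde{\mathcal C}^h(F)=\bigoplus_{h(H)=h}A(H)$ with differential the sum of per-edge maps; $\mathcal C(F)=\widetilde{\mathcal C}(F)[-e(F)]$; $H$ denotes homology. Associated link: embed $F$ in $S^2$ and form the alternating link diagram $L$ with one crossing per edge of $F$ (the medial construction), connected according to the cyclic orders at the vertices, such that at the crossing of edge $e$ the $0$-smoothing corresponds to keeping the edge $e$ and the $1$-smoothing to deleting it; thus for every state $H$, smoothing the crossings of edges of $H$ by $0$ and the others by $1$ yields a set of circles in bijection with the boundary components of $H$, and the number of $1$-smoothings is $h(H)$. Unnormalized Khovanov complex $\widetilde{\mathcal C}(L)$: the smoothing corresponding to $H$ gets $V^{\otimes p(H)}\{h(H)\}$, per-edge maps $(-1)^{\sum_{i<j}\alpha_i}\widetilde m'$ or $(-1)^{\sum_{i<j}\alpha_i}\widetilde\Delta'$ on merging/splitting circles, $\widetilde{\mathcal C}^i(L)$ the direct sum over smoothings with $i$ one-smoothings, differential $\widetilde d^i$ the sum of per-edge maps. For an orientation of $L$ with $n_\pm$ positive/negative crossings, the Khovanov complex is $\widetilde{\mathcal C}(L)[-n_-]\{n_+-2n_-\}$, whose homology is the Khovanov homology $HK(L)$. -}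

module Defs where

open import Level using (0ℓ)
open import Function using (_∘_; id)
open import Data.Nat as ℕ using (ℕ; zero; suc)
open import Data.Integer as ℤ using (ℤ; +_; -[1+_]; 0ℤ; 1ℤ; -1ℤ; _+_; _*_; -_; _-_)
import Data.Integer.Properties as ℤP
open import Data.Fin using (Fin; toℕ; splitAt; join)
import Data.Fin as Fin
open import Data.Bool using (Bool; true; false; _∧_; _∨_; not; if_then_else_)
open import Data.List using (List; []; _∷_; _++_; length; map; concatMap; allFin; upTo; filterᵇ; replicate; take; foldr; cartesianProduct; lookup)
open import Data.Bool.ListAction using (any)
open import Data.Maybe using (Maybe; just; nothing)
import Data.Maybe as Maybe
open import Data.Product using (Σ; ∃; _×_; _,_; proj₁; proj₂)
open import Data.Sum using (_⊎_; inj₁; inj₂; [_,_])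
import Data.Sum as Sum
open import Data.Unit using (⊤; tt)
open import Relation.Nullary using (¬_)
open import Relation.Binary.PropositionalEquality using (_≡_; refl; sym; trans; cong; cong₂)
open import Algebra.Bundles.Raw using (RawGroup)
open import Algebra.Morphism.Structures using (module GroupMorphisms)

Σℤ : (n : ℕ) → (Fin n → ℤ) → ℤ
Σℤ zero    f = 0ℤ
Σℤ (suc n) f = f Fin.zero + Σℤ n (f ∘ Fin.suc)

private
  inter : ∀ a b c d → (a + b) + (c + d) ≡ (a + c) + (b + d)
  inter a b c d =
    trans (ℤP.+-assoc a b (c + d))
    (trans (cong (λ t → a + t) (sym (ℤP.+-assoc b c d)))
    (trans (cong (λ t → a + (t + d)) (ℤP.+-comm b c))
    (trans (cong (λ t → a + t) (ℤP.+-assoc c b d))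
           (sym (ℤP.+-assoc a c (b + d))))))

Σℤ-+ : ∀ n (f g : Fin n → ℤ) → Σℤ n (λ k → f k + g k) ≡ Σℤ n f + Σℤ n g
Σℤ-+ zero    f g = refl
Σℤ-+ (suc n) f g =
  trans (cong (λ t → f Fin.zero + g Fin.zero + t) (Σℤ-+ n (f ∘ Fin.suc) (g ∘ Fin.suc)))
        (inter (f Fin.zero) (g Fin.zero) (Σℤ n (f ∘ Fin.suc)) (Σℤ n (g ∘ Fin.suc)))

Σℤ-neg : ∀ n (f : Fin n → ℤ) → Σℤ n (λ k → - f k) ≡ - Σℤ n f
Σℤ-neg zero    f = refl
Σℤ-neg (suc n) f =
  trans (cong (λ t → - f Fin.zero + t) (Σℤ-neg n (f ∘ Fin.suc)))
        (sym (ℤP.neg-distrib-+ (f Fin.zero) (Σℤ n (f ∘ Fin.suc))))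

Σℤ-cong : ∀ n (f g : Fin n → ℤ) → (∀ k → f k ≡ g k) → Σℤ n f ≡ Σℤ n g
Σℤ-cong zero    f g h = refl
Σℤ-cong (suc n) f g h = cong₂ _+_ (h Fin.zero) (Σℤ-cong n (f ∘ Fin.suc) (g ∘ Fin.suc) (h ∘ Fin.suc))

Σℤ-0 : ∀ n (f : Fin n → ℤ) → (∀ k → f k ≡ 0ℤ) → Σℤ n f ≡ 0ℤ
Σℤ-0 zero    f h = refl
Σℤ-0 (suc n) f h = cong₂ _+_ (h Fin.zero) (Σℤ-0 n (f ∘ Fin.suc) (h ∘ Fin.suc))

-- A finitely generated free graded ℤ-module, given by an explicit
-- finite (duplicate-free) list of basis elements and their degrees.
record FMod : Set₁ where
  field
    B    : Set
    enum : List B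
    deg  : B → ℤ

module _ (M : FMod) where
  open FMod M
  rk : ℕ
  rk = length enum

  El : Set
  El = Fin rk → ℤ

  basis : Fin rk → B
  basis = lookup enum

  Homog : ℤ → El → Set
  Homog j x = ∀ k → ¬ (deg (basis k) ≡ j) → x k ≡ 0ℤ

_≋_ : ∀ {n} → (Fin n → ℤ) → (Fin n → ℤ) → Set
x ≋ y = ∀ k → x k ≡ y k

zeroV : ∀ {n} → Fin n → ℤ
zeroV _ = 0ℤ

app : (M₁ M₂ : FMod) → (FMod.B M₁ → FMod.B M₂ → ℤ) → El M₁ → El M₂
app M₁ M₂ c x t = Σℤ (rk M₁) (λ s → c (basis M₁ s) (basis M₂ t) * x s)

module _ (M₁ M₂ : FMod) (c : FMod.B M₁ → FMod.B M₂ → ℤ) where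
  private
    cf : Fin (rk M₂) → Fin (rk M₁) → ℤ
    cf t s = c (basis M₁ s) (basis M₂ t)

  app-+ : ∀ x y t → app M₁ M₂ c (λ k → x k + y k) t ≡ app M₁ M₂ c x t + app M₁ M₂ c y t
  app-+ x y t =
    trans (Σℤ-cong (rk M₁) _ _ (λ s → ℤP.*-distribˡ-+ (cf t s) (x s) (y s)))
          (Σℤ-+ (rk M₁) _ _)

  app-neg : ∀ x t → app M₁ M₂ c (λ k → - x k) t ≡ - app M₁ M₂ c x t
  app-neg x t =
    trans (Σℤ-cong (rk M₁) _ _ (λ s → sym (ℤP.neg-distribʳ-* (cf t s) (x s))))
          (Σℤ-neg (rk M₁) _)

  app-0 : ∀ t → app M₁ M₂ c zeroV t ≡ 0ℤ
  app-0 t = Σℤ-0 (rk M₁) _ (λ s → ℤP.*-zeroʳ (cf t s))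

AbGrp : Set₁
AbGrp = RawGroup 0ℓ 0ℓ

_≅_ : AbGrp → AbGrp → Set
G ≅ H = Σ (RawGroup.Carrier G → RawGroup.Carrier H)
          (GroupMorphisms.IsGroupIsomorphism G H)

SQ : (M₀ M₁ M₂ : FMod) → (FMod.B M₀ → FMod.B M₁ → ℤ) → (FMod.B M₁ → FMod.B M₂ → ℤ) → ℤ → AbGrp
SQ M₀ M₁ M₂ c₀ c₁ j = record
  { Carrier = Σ (El M₁) (λ x → Homog M₁ j x × (app M₁ M₂ c₁ x ≋ zeroV))
  ; _≈_ = λ x y → Σ (El M₀) (λ z → Homog M₀ j z ×
                   (∀ k → proj₁ x k - proj₁ y k ≡ app M₀ M₁ c₀ z k))
  ; _∙_ = λ x y → (λ k → proj₁ x k + proj₁ y k)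
                 , (λ k ne → cong₂ _+_ (proj₁ (proj₂ x) k ne) (proj₁ (proj₂ y) k ne))
                 , (λ t → trans (app-+ M₁ M₂ c₁ (proj₁ x) (proj₁ y) t)
                                (cong₂ _+_ (proj₂ (proj₂ x) t) (proj₂ (proj₂ y) t)))
  ; ε = zeroV , (λ k ne → refl) , app-0 M₁ M₂ c₁
  ; _⁻¹ = λ x → (λ k → - proj₁ x k)
               , (λ k ne → cong -_ (proj₁ (proj₂ x) k ne))
               , (λ t → trans (app-neg M₁ M₂ c₁ (proj₁ x) t) (cong -_ (proj₂ (proj₂ x) t)))
  }

Img : (M₀ M₁ : FMod) → (FMod.B M₀ → FMod.B M₁ → ℤ) → ℤ → AbGrp
Img M₀ M₁ c j = record
  { Carrier = Σ (El M₁) (λ y → Homog M₁ j y ×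
                 Σ (El M₀) (λ x → Homog M₀ j x × (app M₀ M₁ c x ≋ y)))
  ; _≈_ = λ x y → proj₁ x ≋ proj₁ y
  ; _∙_ = λ x y → (λ k → proj₁ x k + proj₁ y k)
                 , (λ k ne → cong₂ _+_ (proj₁ (proj₂ x) k ne) (proj₁ (proj₂ y) k ne))
                 , (λ s → proj₁ (proj₂ (proj₂ x)) s + proj₁ (proj₂ (proj₂ y)) s)
                 , (λ s ne → cong₂ _+_ (proj₁ (proj₂ (proj₂ (proj₂ x))) s ne)
                                       (proj₁ (proj₂ (proj₂ (proj₂ y))) s ne))
                 , (λ t → trans (app-+ M₀ M₁ c _ _ t)
                                (cong₂ _+_ (proj₂ (proj₂ (proj₂ (proj₂ x))) t)
                                           (proj₂ (proj₂ (proj₂ (proj₂ y))) t)))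
  ; ε = zeroV , (λ k ne → refl) , zeroV , (λ k ne → refl) , app-0 M₀ M₁ c
  ; _⁻¹ = λ x → (λ k → - proj₁ x k)
               , (λ k ne → cong -_ (proj₁ (proj₂ x) k ne))
               , (λ s → - proj₁ (proj₂ (proj₂ x)) s)
               , (λ s ne → cong -_ (proj₁ (proj₂ (proj₂ (proj₂ x))) s ne))
               , (λ t → trans (app-neg M₀ M₁ c _ t)
                              (cong -_ (proj₂ (proj₂ (proj₂ (proj₂ x))) t)))
  }

_⊕_ : AbGrp → AbGrp → AbGrp
G ⊕ H = record
  { Carrier = RawGroup.Carrier G × RawGroup.Carrier H
  ; _≈_ = λ x y → RawGroup._≈_ G (proj₁ x) (proj₁ y) × RawGroup._≈_ H (proj₂ x) (proj₂ y)
  ; _∙_ = λ x y → RawGroup._∙_ G (proj₁ x) (proj₁ y) , RawGroup._∙_ H (proj₂ x) (proj₂ y)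
  ; ε = RawGroup.ε G , RawGroup.ε H
  ; _⁻¹ = λ x → RawGroup._⁻¹ G (proj₁ x) , RawGroup._⁻¹ H (proj₂ x)
  }

Trivial : AbGrp
Trivial = record { Carrier = ⊤ ; _≈_ = λ _ _ → ⊤ ; _∙_ = λ _ _ → tt ; ε = tt ; _⁻¹ = λ _ → tt }

⨁ : {I : Set} → List I → (I → AbGrp) → AbGrp
⨁ []       G = Trivial
⨁ (i ∷ is) G = G i ⊕ ⨁ is G

-- Tensor product (over ℤ) of two abelian groups: formal finite sums of
-- pairs a ⊗ b, modulo the congruence generated by bilinearity.
module Tensor (G H : AbGrp) where
  private
    module G = RawGroup G
    module H = RawGroup H
    A = G.Carrier
    B = H.Carrier

  data _∼_ : List (A × B) → List (A × B) → Set where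
    ∼refl  : ∀ {xs} → xs ∼ xs
    ∼sym   : ∀ {xs ys} → xs ∼ ys → ys ∼ xs
    ∼trans : ∀ {xs ys zs} → xs ∼ ys → ys ∼ zs → xs ∼ zs
    ∼++    : ∀ {xs xs' ys ys'} → xs ∼ xs' → ys ∼ ys' → (xs ++ ys) ∼ (xs' ++ ys')
    ∼swap  : ∀ {p q} → (p ∷ q ∷ []) ∼ (q ∷ p ∷ [])
    ∼resp  : ∀ {a a' b b'} → a G.≈ a' → b H.≈ b' → ((a , b) ∷ []) ∼ ((a' , b') ∷ [])
    ∼linˡ  : ∀ {a a' b} → ((a G.∙ a' , b) ∷ []) ∼ ((a , b) ∷ (a' , b) ∷ [])
    ∼linʳ  : ∀ {a b b'} → ((a , b H.∙ b') ∷ []) ∼ ((a , b) ∷ (a , b') ∷ [])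
    ∼zero  : ∀ {b} → ((G.ε , b) ∷ []) ∼ []

  tensor : AbGrp
  tensor = record
    { Carrier = List (A × B)
    ; _≈_ = _∼_
    ; _∙_ = _++_
    ; ε = []
    ; _⁻¹ = map (λ p → G._⁻¹ (proj₁ p) , proj₂ p)
    }

_⊗_ : AbGrp → AbGrp → AbGrp
G ⊗ H = Tensor.tensor G H

infixr 6 _⊕_
infixr 7 _⊗_

-- A cochain complex (ℤ-indexed) of finitely generated free graded
-- ℤ-modules with a common basis type: C^i is free on  enum i  (a
-- duplicate-free list), basis elements have internal degree  deg, and
-- the differential sends a basis element b of C^i to
-- Σ_{b' ∈ enum (i+1)} coef b b' · b'.
record Cx : Set₁ where
  field
    B    : Set
    enum : ℤ → List B
    deg  : B → ℤ
    coef : B → B → ℤ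

module _ (C : Cx) where
  open Cx C
  Lvl : ℤ → FMod
  Lvl i = record { B = B ; enum = enum i ; deg = deg }

Hom : Cx → ℤ → ℤ → AbGrp
Hom C i j = SQ (Lvl C (ℤ.pred i)) (Lvl C i) (Lvl C (ℤ.suc i)) (Cx.coef C) (Cx.coef C) j

Zero : FMod
Zero = record { B = ⊤ ; enum = [] ; deg = λ _ → 0ℤ }

Cyc : Cx → ℤ → ℤ → AbGrp
Cyc C i j = SQ Zero (Lvl C i) (Lvl C (ℤ.suc i)) (λ _ _ → 0ℤ) (Cx.coef C) j

shift : Cx → ℤ → Cx
shift C s = record C { enum = λ i → Cx.enum C (i - s) }

allLists : {A : Set} → ℕ → List A → List (List A)
allLists zero    xs = [] ∷ []
allLists (suc n) xs = concatMap (λ a → map (a ∷_) (allLists n xs)) xs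

count : {A : Set} → (A → Bool) → List A → ℕ
count p xs = length (filterᵇ p xs)

at : {A : Set} → A → List A → ℕ → A
at d []       _       = d
at d (x ∷ xs) zero    = x
at d (x ∷ xs) (suc n) = at d xs n

iter : {A : Set} → (A → A) → ℕ → A → A
iter f zero    x = x
iter f (suc n) x = f (iter f n x)

[_]ℤ : Bool → ℤ
[ true ]ℤ  = 1ℤ
[ false ]ℤ = 0ℤ

eqB : Bool → Bool → Bool
eqB true  true  = true
eqB false false = true
eqB _     _     = false

eqList : {A : Set} → (A → A → Bool) → List A → List A → Bool
eqList e []       []       = true
eqList e (x ∷ xs) (y ∷ ys) = e x y ∧ eqList e xs ys
eqList e _        _        = false

prodℤ : List ℤ → ℤ
prodℤ = foldr _*_ 1ℤ

sumℤ : List ℤ → ℤ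
sumℤ = foldr _+_ 0ℤ

range : ℤ → ℕ → List ℤ
range a zero    = []
range a (suc n) = a ∷ range (ℤ.suc a) n

data Sgn : Set where
  v₊ v₋ : Sgn

degV : Sgn → ℤ
degV v₊ = 1ℤ
degV v₋ = -1ℤ

eqS : Sgn → Sgn → Bool
eqS v₊ v₊ = true
eqS v₋ v₋ = true
eqS _  _  = false

data RB : Set where
  x₀ x₋₂ : RB

degR : RB → ℤ
degR x₀  = 0ℤ
degR x₋₂ = - (+ 2)

eqR : RB → RB → Bool
eqR x₀  x₀  = true
eqR x₋₂ x₋₂ = true
eqR _   _   = false

-- coefficient of c in m'(a ⊗ b)
m'coef : Sgn → Sgn → Sgn → ℤ
m'coef v₊ v₊ v₊ = 1ℤ
m'coef v₊ v₋ v₋ = 1ℤ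
m'coef v₋ v₊ v₋ = 1ℤ
m'coef _  _  _  = 0ℤ

-- coefficient of b ⊗ c in Δ'(a)
Δ'coef : Sgn → Sgn → Sgn → ℤ
Δ'coef v₊ v₊ v₋ = 1ℤ
Δ'coef v₊ v₋ v₊ = 1ℤ
Δ'coef v₋ v₋ v₋ = 1ℤ
Δ'coef _  _  _  = 0ℤ

-- coefficient of b ⊗ c in the image of a under x₀ ↦ x₀⊗x₀,
-- x₋₂ ↦ x₋₂⊗x₀ + x₀⊗x₋₂
ΔRcoef : RB → RB → RB → ℤ
ΔRcoef x₀  x₀  x₀  = 1ℤ
ΔRcoef x₋₂ x₋₂ x₀  = 1ℤ
ΔRcoef x₋₂ x₀  x₋₂ = 1ℤ
ΔRcoef _   _   _   = 0ℤ

-- coefficient of the basis tensor r' ∈ R^{⊗(h+1)} in Δ̄_h(r), r ∈ R^{⊗h}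
-- (Δ̄_0 : 1 ↦ x₀ ; for h ≥ 1 Δ̄_h acts on the last factor)
Δ̄coef : List RB → List RB → ℤ
Δ̄coef []              (b ∷ [])      = [ eqR b x₀ ]ℤ
Δ̄coef (a ∷ [])        (b ∷ c ∷ [])  = ΔRcoef a b c
Δ̄coef (a ∷ a₂ ∷ r)    (b ∷ r')      = [ eqR a b ]ℤ * Δ̄coef (a₂ ∷ r) r'
Δ̄coef _               _             = 0ℤ

degVs : List Sgn → ℤ
degVs = sumℤ ∘ map degV

degRs : List RB → ℤ
degRs = sumℤ ∘ map degR

V⊗ : ℕ → FMod
V⊗ n = record { B = List Sgn ; enum = allLists n (v₊ ∷ v₋ ∷ []) ; deg = degVs }

R⊗ : ℕ → FMod
R⊗ n = record { B = List RB ; enum = allLists n (x₀ ∷ x₋₂ ∷ []) ; deg = degRs }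

-- the domain of Δ̄_{i-1} : R^{⊗(i-1)} → R^{⊗ i}; for i = 0 there is no
-- such map and the domain is taken to be 0 (so its image is 0).
predEnum : ℕ → List (List RB)
predEnum zero    = []
predEnum (suc n) = allLists n (x₀ ∷ x₋₂ ∷ [])

R⊗pred : ℕ → FMod
R⊗pred n = record { B = List RB ; enum = predEnum n ; deg = degRs }

-- A fatgraph with nv vertices (numbered 0..nv-1) and ne edges (numbered
-- 0..ne-1, the paper's 1..n).  Half-edges ("darts") are Fin (ne + ne):
-- edge e has the two half-edges  inj₁ e  and  inj₂ e  (via splitAt/join).
-- vtx gives the vertex of a half-edge; σ is the successor in the cyclic
-- order of the half-edges at their vertex, so the half-edges at each
-- vertex form a single σ-cycle.  (Loops and multiple edges are allowed;
-- vertices without half-edges are isolated vertices.)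
record Fatgraph : Set where
  field
    nv ne  : ℕ
    σ σ⁻¹  : Fin (ne ℕ.+ ne) → Fin (ne ℕ.+ ne)
    σ-σ⁻¹  : ∀ h → σ (σ⁻¹ h) ≡ h
    σ⁻¹-σ  : ∀ h → σ⁻¹ (σ h) ≡ h
    vtx    : Fin (ne ℕ.+ ne) → Fin nv
    vtx-σ  : ∀ h → vtx (σ h) ≡ vtx h
    vtx-cyc : ∀ h h' → vtx h ≡ vtx h' → Σ ℕ (λ k → iter σ k h ≡ h')

pm : ℕ → ℤ
pm zero    = 1ℤ
pm (suc n) = - pm n

-- if α' is obtained from α by changing exactly one entry, at position j,
-- from false (edge present) to true (edge deleted), return just j
oneMore : List Bool → List Bool → Maybe ℕ
oneMore []      []      = nothing
oneMore (a ∷ α) (b ∷ β) =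
  if eqB a b then Maybe.map suc (oneMore α β)
  else (if (not a ∧ b) ∧ eqList eqB α β then just 0 else nothing)
oneMore _       _       = nothing

module FG (F : Fatgraph) where
  open Fatgraph F public

  Dart : Set
  Dart = Fin (ne ℕ.+ ne)

  darts : List Dart
  darts = allFin (ne ℕ.+ ne)

  ι : Dart → Dart
  ι x = join ne ne (Sum.swap (splitAt ne x))

  edge : Dart → ℕ
  edge x = [ toℕ , toℕ ] (splitAt ne x)

  -- States H = (V(F), W) are encoded by α ∈ {0,1}^n as a list of ne
  -- booleans: α_i = false (0) iff edge i is present in H.
  State : Set
  State = List Bool

  states : ℕ → List State
  states h = filterᵇ (λ α → count id α ℕ.≡ᵇ h) (allLists ne (false ∷ true ∷ []))

  height : State → ℕ
  height α = count id α

  present : State → Dart → Bool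
  present α x = not (at false α (edge x))

  -- Boundary components of a state.  A half-edge x of F also names the
  -- corner of F following x (between x and σ x).  Walking along the
  -- boundary of H, the corner x is followed by the corner  next α x :
  -- if σ x is present in H we cross to the other end ι (σ x) of its
  -- edge, otherwise we stay in the same corner of H and pass to σ x.
  -- The orbits of  next α  are exactly the boundary components of H
  -- that meet a vertex of positive degree in F; the remaining boundary
  -- components are those of the vertices of degree 0 in F.
  next : State → Dart → Dart
  next α x = if present α (σ x) then ι (σ x) else σ x

  repℕ : State → Dart → ℕ
  repℕ α x = foldr ℕ._⊓_ (toℕ x) (map (λ k → toℕ (iter (next α) k x)) (upTo (ne ℕ.+ ne)))

  isRep : State → Dart → Bool
  isRep α x = repℕ α x ℕ.≡ᵇ toℕ x

  nOrb : State → ℕ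
  nOrb α = count (isRep α) darts

  orbIdx : State → Dart → ℕ
  orbIdx α x = count (λ y → isRep α y ∧ (toℕ y ℕ.<ᵇ repℕ α x)) darts

  nIso : ℕ
  nIso = count (λ v → not (any (λ x → toℕ (vtx x) ℕ.≡ᵇ toℕ v) darts)) (allFin nv)

  bdry : State → ℕ
  bdry α = nOrb α ℕ.+ nIso

  reach : ℕ → Fin nv → Fin nv → Bool
  reach zero    u w = toℕ u ℕ.≡ᵇ toℕ w
  reach (suc t) u w = reach t u w ∨
    any (λ x → reach t u (vtx x) ∧ (toℕ (vtx (ι x)) ℕ.≡ᵇ toℕ w)) darts

  connected : Fin nv → Fin nv → Bool
  connected = reach nv

  ncomp : ℕ
  ncomp = count (λ u → not (any (λ w → (toℕ w ℕ.<ᵇ toℕ u) ∧ connected w u) (allFin nv)))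
                (allFin nv)

  fullState : State
  fullState = replicate ne false

  -- F has genus 0 :  the genus  g(F) = Σ over components of
  -- (2 - v + e - p)/2  vanishes, i.e.  v(F) - e(F) + p(F) = 2·#components
  Genus0 : Set
  Genus0 = nv ℕ.+ bdry fullState ≡ 2 ℕ.* ncomp ℕ.+ ne

  -- For state α and α' = α minus one edge: the coefficient of the basis
  -- tensor s' of V^{⊗ nOrb α'} in the image of the basis tensor s of
  -- V^{⊗ nOrb α} under m' (on the two merging boundary components) or Δ'
  -- (on the splitting one), identity elsewhere.  Boundary components of
  -- α and α' correspond when they share a corner.
  rel : State → State → ℕ → ℕ → Bool
  rel α α' a c = any (λ x → (orbIdx α x ℕ.≡ᵇ a) ∧ (orbIdx α' x ℕ.≡ᵇ c)) darts

  mergeF : List Sgn → List Sgn → List ℕ → ℕ → ℤ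
  mergeF s s' (a ∷ [])     c = [ eqS (at v₊ s a) (at v₊ s' c) ]ℤ
  mergeF s s' (a ∷ b ∷ []) c = m'coef (at v₊ s a) (at v₊ s b) (at v₊ s' c)
  mergeF s s' _            c = 0ℤ

  splitF : List Sgn → List Sgn → ℕ → List ℕ → ℤ
  splitF s s' a (c ∷ [])      = [ eqS (at v₊ s a) (at v₊ s' c) ]ℤ
  splitF s s' a (c ∷ d ∷ [])  = Δ'coef (at v₊ s a) (at v₊ s' c) (at v₊ s' d)
  splitF s s' a _             = 0ℤ

  bcoef : State → State → List Sgn → List Sgn → ℤ
  bcoef α α' s s' =
    if nOrb α' ℕ.<ᵇ nOrb α
    then prodℤ (map (λ c → mergeF s s' (filterᵇ (λ a → rel α α' a c) (upTo (nOrb α))) c)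
                    (upTo (nOrb α')))
    else prodℤ (map (λ a → splitF s s' a (filterᵇ (λ c → rel α α' a c) (upTo (nOrb α'))))
                    (upTo (nOrb α)))

  Sgns : List Sgn
  Sgns = v₊ ∷ v₋ ∷ []

  RBs : List RB
  RBs = x₀ ∷ x₋₂ ∷ []

  -- The chromatic complex  C̃(F).  A basis element of A(H) is
  -- (α , vertex factors , factors of the boundary components at vertices
  --  of degree 0 , factors of the other boundary components , R-factors).
  ChB : Set
  ChB = State × List Sgn × List Sgn × List Sgn × List RB

  enumCh : ℤ → List ChB
  enumCh (+ i) =
    concatMap (λ α →
      concatMap (λ vs →
        concatMap (λ zs →
          concatMap (λ ss →
            map (λ rs → α , vs , zs , ss , rs) (allLists i RBs))
          (allLists (nOrb α) Sgns))
        (allLists nIso Sgns))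
      (allLists nv Sgns))
    (states i)
  enumCh -[1+ _ ] = []

  -- internal degree, including the shift {h(H)}
  degCh : ChB → ℤ
  degCh (α , vs , zs , ss , rs) = degVs vs + degVs zs + degVs ss + degRs rs + + height α

  coefCh : ChB → ChB → ℤ
  coefCh (α , vs , zs , ss , rs) (α' , vs' , zs' , ss' , rs') with oneMore α α'
  ... | nothing = 0ℤ
  ... | just j  = pm (count id (take j α))
                  * [ eqList eqS vs vs' ∧ eqList eqS zs zs' ]ℤ
                  * bcoef α α' ss ss'
                  * Δ̄coef rs rs'

  C̃F : Cx
  C̃F = record { B = ChB ; enum = enumCh ; deg = degCh ; coef = coefCh }

  CF : Cx
  CF = shift C̃F (- (+ ne))

  -- The unnormalized Khovanov complex C̃(L) of the associated link: the
  -- smoothing of state α has one circle per boundary component of α.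
  KhB : Set
  KhB = State × List Sgn × List Sgn

  enumKh : ℤ → List KhB
  enumKh (+ i) =
    concatMap (λ α →
      concatMap (λ zs →
        map (λ ss → α , zs , ss) (allLists (nOrb α) Sgns))
      (allLists nIso Sgns))
    (states i)
  enumKh -[1+ _ ] = []

  degKh : KhB → ℤ
  degKh (α , zs , ss) = degVs zs + degVs ss + + height α

  coefKh : KhB → KhB → ℤ
  coefKh (α , zs , ss) (α' , zs' , ss') with oneMore α α'
  ... | nothing = 0ℤ
  ... | just j  = pm (count id (take j α))
                  * [ eqList eqS zs zs' ]ℤ
                  * bcoef α α' ss ss'

  C̃L : Cx
  C̃L = record { B = KhB ; enum = enumKh ; deg = degKh ; coef = coefKh }

  -- a bound on |internal degree| of C̃(L); outside it HK and Z vanish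
  degBound : ℕ
  degBound = 3 ℕ.* ne ℕ.+ nv ℕ.+ 1

  pRange : List ℤ
  pRange = range (- (+ degBound)) (2 ℕ.* degBound ℕ.+ 1)

-- Δ̄(R^{⊗(i-1)})_q ⊆ R^{⊗ i}_q   (Δ̄ = Δ̄_{i-1}; for i = 0 this is 0)
ImΔ̄ : ℕ → ℤ → AbGrp
ImΔ̄ i q = Img (R⊗pred i) (R⊗ i) Δ̄coef q

CokΔ̄ : ℕ → ℤ → AbGrp
CokΔ̄ i q = SQ (R⊗pred i) (R⊗ i) Zero Δ̄coef (λ _ _ → 0ℤ) q

V⊗deg : ℕ → ℤ → AbGrp
V⊗deg n r = SQ Zero (V⊗ n) Zero (λ _ _ → 0ℤ) (λ _ _ → 0ℤ) r

qRange : ℕ → List ℤ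
qRange i = range (- (+ (2 ℕ.* i))) (2 ℕ.* i ℕ.+ 1)

-- ⊕_{p+q+r=j} ((HK^i_p ⊗ Δ̄(R^{⊗(i-1)})_q) ⊕ (Z^i_p ⊗ R^{⊗i}_q/Δ̄(..)_q)) ⊗ (V^{⊗v(F)})_r
-- (p ranges over all possible degrees of C̃(L), q over all degrees of R^{⊗i};
--  all other summands are 0)
RHS : Fatgraph → ℕ → ℤ → AbGrp
RHS F i j =
  ⨁ (cartesianProduct pRange (qRange i)) λ pq →
    ((Hom C̃L (+ i) (proj₁ pq) ⊗ ImΔ̄ i (proj₂ pq))
       ⊕ (Cyc C̃L (+ i) (proj₁ pq) ⊗ CokΔ̄ i (proj₂ pq)))
    ⊗ V⊗deg nv (j - proj₁ pq - proj₂ pq)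
  where open FG F

{-# OPTIONS --safe #-}
module Submission where

open import Defs
open import Data.Nat using (ℕ)
open import Data.Integer using (ℤ; +_; _+_)
open import Data.Product using (_×_)

open import Level using (0ℓ)
open import Algebra.Bundles using (AbelianGroup)
open import Algebra.Bundles.Raw using (RawGroup)
import Algebra.Properties.AbelianGroup as AbelianGroupProperties
import Algebra.Properties.CommutativeMonoid.Sum as MonoidSum
import Algebra.Properties.CommutativeSemigroup as CommutativeSemigroupProperties
import Algebra.Properties.Monoid.Mult as Mult
open import Algebra.Structures using (IsAbelianGroup)
open import Axiom.UniquenessOfIdentityProofs.WithK using (uip)
open import Data.Bool using (Bool; true; false; _∧_)
open import Data.Fin using (Fin; zero; suc; combine; remQuot; _↑ˡ_; _↑ʳ_)
import Data.Fin.Properties as FinP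
open import Data.Integer as ℤ using (-[1+_]; 0ℤ; 1ℤ; -1ℤ; _*_; -_; _-_)
import Data.Integer.Properties as ℤP
open import Data.Integer.Tactic.RingSolver using (solve-∀)
open import Data.List
  using (List; []; _∷_; _++_; _∷ʳ_; length; lookup; map; concatMap; take; cartesianProduct; initLast; _∷ʳ′_; allFin)
import Data.List.Membership.DecPropositional as DecMembership
open import Data.List.Membership.Propositional using (_∈_; find; lose)
open import Data.List.Membership.Propositional.Properties
  using (∈-map⁺; ∈-map⁻; ∈-concatMap⁺; ∈-concatMap⁻; ∈-filter⁻; ∈-lookup; ∈-cartesianProduct⁺)
import Data.List.Properties as ListP
import Data.List.Relation.Unary.All as All
open import Data.List.Relation.Unary.AllPairs using ([]; _∷_)
open import Data.List.Relation.Unary.Any as Any using (here; there)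
open import Data.List.Relation.Unary.Any.Properties using (lookup-index)
open import Data.List.Relation.Unary.Unique.Propositional using (Unique)
import Data.List.Relation.Unary.Unique.Propositional.Properties as UniqueP
open import Data.Maybe using (just; nothing)
open import Data.Nat as ℕ using (zero; suc; s≤s; z≤n)
import Data.Nat.Properties as ℕP
open import Data.Nat.Tactic.RingSolver using () renaming (solve-∀ to ℕ-solve-∀)
open import Data.Product using (Σ; _,_; proj₁; proj₂)
open import Data.Product.Function.NonDependent.Propositional using (_×-↔_)
import Data.Product.Properties as ProductP
open import Data.Sum using (_⊎_; inj₁; inj₂; [_,_])
open import Data.Unit using (tt)
open import Function using (_∘_; id; _↔_; mk↔ₛ′; Inverse)
open import Function.Construct.Composition using (_↔-∘_)
open import Function.Construct.Identity using (↔-id)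
open import Relation.Binary.Bundles using (Setoid)
open import Relation.Binary.PropositionalEquality hiding (setoid; [_])
import Relation.Binary.Reasoning.Setoid as SetoidReasoning
open import Relation.Binary.Structures using (IsEquivalence)
open import Relation.Nullary using (¬_; yes; no; contradiction; Dec)
open import Relation.Nullary.Decidable using (T?)

-- The differential of C̃(F) is id ⊗ d ⊗ Δ̄ on V^{⊗v} ⊗ C̃(L) ⊗ R^{⊗i}, where d is the Khovanov
-- differential.  The map Δ̄ has a retraction (the coefficient at r ⊗ x₀ recovers the coefficient of
-- r), so it is injective onto a direct summand.  Hence the cycles are V^{⊗v} ⊗ Z ⊗ R^{⊗i}, the
-- boundaries are V^{⊗v} ⊗ B ⊗ Δ̄(R^{⊗(i-1)}), and splitting R^{⊗i} into the image of Δ̄ and a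
-- complement gives the quotient.  Everything tensored with Z or HK is free of finite rank, so each
-- tensor product is a finite power, and it remains to match the two indexings by degrees.

-- Isomorphisms of abelian groups

-- Boundaries have R-part in the image of `Δ̄`. Hence the component of a cycle along the image
-- counts modulo Khovanov boundaries, which gives homology, while along the complement nothing is
-- divided out, which gives all cycles. The retraction serves at two consecutive stages: for the
-- incoming map it provides the splitting, and for the outgoing map it shows that every R-component
-- of a cycle is a Khovanov cycle. Plain coordinates do not respect this picture: `Δ̄` of a tensor r
-- ⊗ x₋₂ contains the term r ⊗ x₀ ⊗ x₋₂, so the complement coordinates of a boundary need not
-- vanish. They become invariant after subtracting `Δ̄` of the image coordinates. In the degree
-- matching, the left side has one factor for each pair of basis elements of V^{⊗v} and R^{⊗i},
-- whereas the right side sums over a finite window of pairs (p , q). The two agree because the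
-- window has no repetitions and factors in degrees outside it contain only zero.

∣_∣ : AbGrp → Set
∣ G ∣ = RawGroup.Carrier G

IsAb : AbGrp → Set
IsAb G = IsAbelianGroup (RawGroup._≈_ G) (RawGroup._∙_ G) (RawGroup.ε G) (RawGroup._⁻¹ G)

bundle : (G : AbGrp) → IsAb G → AbelianGroup 0ℓ 0ℓ
bundle G ab = record { isAbelianGroup = ab }

module _ (G : AbGrp) where
  open RawGroup G

  mkIsAb : IsEquivalence _≈_ →
    (∀ {x y u v} → x ≈ y → u ≈ v → x ∙ u ≈ y ∙ v) →
    (∀ x y z → (x ∙ y) ∙ z ≈ x ∙ (y ∙ z)) →
    (∀ x → ε ∙ x ≈ x) →
    (∀ x → (x ⁻¹) ∙ x ≈ ε) →
    (∀ {x y} → x ≈ y → x ⁻¹ ≈ y ⁻¹) →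
    (∀ x y → x ∙ y ≈ y ∙ x) → IsAb G
  mkIsAb eq ∙-cong assoc idˡ invˡ ⁻¹-cong comm = record
    { isGroup = record
      { isMonoid = record
        { isSemigroup = record
          { isMagma = record { isEquivalence = eq ; ∙-cong = ∙-cong }
          ; assoc = assoc }
        ; identity = idˡ , λ x → ≈trans (comm x _) (idˡ x) }
      ; inverse = invˡ , (λ x → ≈trans (comm x _) (invˡ x))
      ; ⁻¹-cong = ⁻¹-cong }
    ; comm = comm }
    where open IsEquivalence eq using () renaming (trans to ≈trans)

-- `AbGrp` carries operations without laws, so the laws of both sides travel with the map. With
-- them, a trivial kernel and surjectivity suffice: injectivity and compatibility with unit and
-- inverses follow.
record Iso (G H : AbGrp) : Set where
  private
    module G = RawGroup G
    module H = RawGroup H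
  field
    abˡ  : IsAb G
    abʳ  : IsAb H
    to   : ∣ G ∣ → ∣ H ∣
    ≈-cong : ∀ {x y} → x G.≈ y → to x H.≈ to y
    homo : ∀ x y → to (x G.∙ y) H.≈ to x H.∙ to y
    ker  : ∀ x → to x H.≈ H.ε → x G.≈ G.ε
    surj : ∀ y → Σ ∣ G ∣ λ x → to x H.≈ y

module IsoProperties {G H : AbGrp} (φ : Iso G H) where
  open Iso φ public
  private
    AG = bundle G abˡ
    AH = bundle H abʳ
    module G = AbelianGroup AG
    module H = AbelianGroup AH
    module GP = AbelianGroupProperties AG
    module HP = AbelianGroupProperties AH

  to-ε : to G.ε H.≈ H.ε
  to-ε = HP.identityˡ-unique _ _ (H.trans (H.sym (homo _ G.ε)) (≈-cong (G.identityˡ _)))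

  to-⁻¹ : ∀ x → to (x G.⁻¹) H.≈ to x H.⁻¹
  to-⁻¹ x = HP.inverseˡ-unique _ _ (H.trans (H.sym (homo _ _)) (H.trans (≈-cong (G.inverseˡ x)) to-ε))

  injective : ∀ {x y} → to x H.≈ to y → x G.≈ y
  injective {x} {y} eq = GP.x∙y⁻¹≈ε⇒x≈y x y (ker _
    (H.trans (homo _ _) (H.trans (H.∙-cong eq (to-⁻¹ y)) (H.inverseʳ _))))

  from : ∣ H ∣ → ∣ G ∣
  from y = proj₁ (surj y)

  to-from : ∀ y → to (from y) H.≈ y
  to-from y = proj₂ (surj y)

  Iso⇒≅ : G ≅ H
  Iso⇒≅ = to , record
    { isGroupMonomorphism = record
      { isGroupHomomorphism = record
        { isMonoidHomomorphism = record
          { isMagmaHomomorphism = record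
            { isRelHomomorphism = record { cong = ≈-cong }
            ; homo = homo }
          ; ε-homo = to-ε }
        ; ⁻¹-homo = to-⁻¹ }
      ; injective = injective }
    ; surjective = λ y → from y , λ eq → H.trans (≈-cong eq) (to-from y) }

open IsoProperties using (Iso⇒≅)

Iso-refl : {G : AbGrp} → IsAb G → Iso G G
Iso-refl ab = record
  { abˡ = ab ; abʳ = ab ; to = λ x → x ; ≈-cong = λ eq → eq ; homo = λ _ _ → G.refl
  ; ker = λ _ eq → eq ; surj = λ y → y , G.refl }
  where module G = IsAbelianGroup ab

Iso-trans : {G H K : AbGrp} → Iso G H → Iso H K → Iso G K
Iso-trans φ ψ = record
  { abˡ = φ.abˡ ; abʳ = ψ.abʳ ; to = ψ.to ∘ φ.to
  ; ≈-cong = ψ.≈-cong ∘ φ.≈-cong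
  ; homo = λ x y → K.trans (ψ.≈-cong (φ.homo x y)) (ψ.homo _ _)
  ; ker = λ x eq → φ.ker x (ψ.ker _ eq)
  ; surj = λ y → φ.from (ψ.from y) , K.trans (ψ.≈-cong (φ.to-from _)) (ψ.to-from y) }
  where
  module φ = IsoProperties φ
  module ψ = IsoProperties ψ
  module K = IsAbelianGroup ψ.abʳ

Iso-sym : {G H : AbGrp} → Iso G H → Iso H G
Iso-sym φ = record
  { abˡ = abʳ ; abʳ = abˡ ; to = from
  ; ≈-cong = λ eq → injective (H.trans (to-from _) (H.trans eq (H.sym (to-from _))))
  ; homo = λ x y → injective (H.trans (to-from _)
      (H.sym (H.trans (homo _ _) (H.∙-cong (to-from x) (to-from y)))))
  ; ker = λ y eq → H.trans (H.sym (to-from y)) (H.trans (≈-cong eq) to-ε)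
  ; surj = λ x → to x , injective (to-from (to x)) }
  where
  open IsoProperties φ
  module H = IsAbelianGroup abʳ

-- Products and direct sums of abelian groups.

Π : (I : Set) → (I → AbGrp) → AbGrp
Π I G = record
  { Carrier = ∀ i → ∣ G i ∣
  ; _≈_ = λ f g → ∀ i → RawGroup._≈_ (G i) (f i) (g i)
  ; _∙_ = λ f g i → RawGroup._∙_ (G i) (f i) (g i)
  ; ε   = λ i → RawGroup.ε (G i)
  ; _⁻¹ = λ f i → RawGroup._⁻¹ (G i) (f i)
  }

Π-isAb : {I : Set} {G : I → AbGrp} → (∀ i → IsAb (G i)) → IsAb (Π I G)
Π-isAb ab = mkIsAb _
  (record { refl = λ i → A.refl i ; sym = λ eq i → A.sym i (eq i)
          ; trans = λ p q i → A.trans i (p i) (q i) })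
  (λ p q i → A.∙-cong i (p i) (q i))
  (λ x y z i → A.assoc i _ _ _)
  (λ x i → A.identityˡ i _)
  (λ x i → A.inverseˡ i _)
  (λ p i → A.⁻¹-cong i (p i))
  (λ x y i → A.comm i _ _)
  where module A i = IsAbelianGroup (ab i)

⊕-isAb : {G H : AbGrp} → IsAb G → IsAb H → IsAb (G ⊕ H)
⊕-isAb {G} {H} abG abH = mkIsAb (G ⊕ H)
  (record { refl = A.refl , B.refl ; sym = λ (p , q) → A.sym p , B.sym q
          ; trans = λ (p , q) (p' , q') → A.trans p p' , B.trans q q' })
  (λ (p , q) (p' , q') → A.∙-cong p p' , B.∙-cong q q')
  (λ x y z → A.assoc _ _ _ , B.assoc _ _ _)
  (λ x → A.identityˡ _ , B.identityˡ _)
  (λ x → A.inverseˡ _ , B.inverseˡ _)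
  (λ (p , q) → A.⁻¹-cong p , B.⁻¹-cong q)
  (λ x y → A.comm _ _ , B.comm _ _)
  where
  module A = IsAbelianGroup abG
  module B = IsAbelianGroup abH

⨁-isAb : {I : Set} (is : List I) {G : I → AbGrp} → (∀ i → IsAb (G i)) → IsAb (⨁ is G)
⨁-isAb [] ab = mkIsAb Trivial (record { refl = tt ; sym = λ _ → tt ; trans = λ _ _ → tt })
  (λ _ _ → tt) (λ _ _ _ → tt) (λ _ → tt) (λ _ → tt) (λ _ → tt) (λ _ _ → tt)
⨁-isAb (i ∷ is) ab = ⊕-isAb (ab i) (⨁-isAb is ab)

Π-cong : {I : Set} {G H : I → AbGrp} → (∀ i → Iso (G i) (H i)) → Iso (Π I G) (Π I H)
Π-cong φ = record
  { abˡ = Π-isAb (λ i → φ.abˡ i) ; abʳ = Π-isAb (λ i → φ.abʳ i)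
  ; to = λ f i → φ.to i (f i)
  ; ≈-cong = λ eq i → φ.≈-cong i (eq i)
  ; homo = λ x y i → φ.homo i _ _
  ; ker = λ x eq i → φ.ker i _ (eq i)
  ; surj = λ y → (λ i → φ.from i (y i)) , λ i → φ.to-from i (y i) }
  where module φ i = IsoProperties (φ i)

⊕-cong : {G G' H H' : AbGrp} → Iso G G' → Iso H H' → Iso (G ⊕ H) (G' ⊕ H')
⊕-cong φ ψ = record
  { abˡ = ⊕-isAb φ.abˡ ψ.abˡ ; abʳ = ⊕-isAb φ.abʳ ψ.abʳ
  ; to = λ (x , y) → φ.to x , ψ.to y
  ; ≈-cong = λ (p , q) → φ.≈-cong p , ψ.≈-cong q
  ; homo = λ _ _ → φ.homo _ _ , ψ.homo _ _
  ; ker = λ _ (p , q) → φ.ker _ p , ψ.ker _ q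
  ; surj = λ (x , y) → (φ.from x , ψ.from y) , φ.to-from x , ψ.to-from y }
  where
  module φ = IsoProperties φ
  module ψ = IsoProperties ψ

⨁≅Π : {I : Set} (is : List I) {G : I → AbGrp} → (∀ i → IsAb (G i)) →
  Iso (⨁ is G) (Π (Fin (length is)) (G ∘ lookup is))
⨁≅Π [] {G} ab = record
  { abˡ = ⨁-isAb [] ab ; abʳ = Π-isAb {G = G ∘ lookup []} (λ ()) ; to = λ _ () ; ≈-cong = λ _ () ; homo = λ _ _ ()
  ; ker = λ _ _ → tt ; surj = λ _ → tt , λ () }
⨁≅Π (i ∷ is) {G} ab = record
  { abˡ = ⨁-isAb (i ∷ is) ab ; abʳ = Π-isAb (ab ∘ lookup (i ∷ is))
  ; to = to′
  ; ≈-cong = λ { (p , q) zero → p ; (p , q) (suc k) → φ.≈-cong q k }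
  ; homo = λ { x y zero → A.refl ; x y (suc k) → φ.homo _ _ k }
  ; ker = λ x eq → eq zero , φ.ker _ (eq ∘ suc)
  ; surj = λ y → (y zero , φ.from (y ∘ suc)) , λ { zero → A.refl ; (suc k) → φ.to-from (y ∘ suc) k } }
  where
  module A = IsAbelianGroup (ab i)
  module φ = IsoProperties (⨁≅Π is {G} ab)
  to′ : ∣ ⨁ (i ∷ is) G ∣ → ∣ Π (Fin (length (i ∷ is))) (G ∘ lookup (i ∷ is)) ∣
  to′ (x , xs) zero    = x
  to′ (x , xs) (suc k) = φ.to xs k

-- Only for constant families: a dependent family would have to be transported along the bijection
Π-reindex : {I J : Set} {G : AbGrp} → IsAb G → I ↔ J → Iso (Π J (λ _ → G)) (Π I (λ _ → G))
Π-reindex {G = G} ab e = record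
  { abˡ = Π-isAb (λ _ → ab) ; abʳ = Π-isAb (λ _ → ab)
  ; to = λ f → f ∘ e.to
  ; ≈-cong = λ eq → eq ∘ e.to
  ; homo = λ _ _ _ → A.refl
  ; ker = λ x eq j → subst (λ k → x k A.≈ RawGroup.ε G) (e.strictlyInverseˡ j) (eq (e.from j))
  ; surj = λ y → y ∘ e.from , λ i → A.reflexive (cong y (e.strictlyInverseʳ i)) }
  where
  module A = AbelianGroup (bundle G ab)
  module e = Inverse e

Π-⊎ : {I J : Set} {P : I ⊎ J → Set} {G : I ⊎ J → AbGrp} → (∀ k → IsAb (G k)) →
  Iso (Π (Σ I (P ∘ inj₁)) (G ∘ inj₁ ∘ proj₁) ⊕ Π (Σ J (P ∘ inj₂)) (G ∘ inj₂ ∘ proj₁))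
      (Π (Σ (I ⊎ J) P) (G ∘ proj₁))
Π-⊎ {P = P} {G} ab = record
  { abˡ = ⊕-isAb (Π-isAb (ab ∘ inj₁ ∘ proj₁)) (Π-isAb (ab ∘ inj₂ ∘ proj₁))
  ; abʳ = Π-isAb (ab ∘ proj₁)
  ; to = λ { (f , g) (inj₁ i , p) → f (i , p) ; (f , g) (inj₂ j , p) → g (j , p) }
  ; ≈-cong = λ { (f , g) (inj₁ i , p) → f (i , p) ; (f , g) (inj₂ j , p) → g (j , p) }
  ; homo = λ { x y (inj₁ i , p) → A.refl (inj₁ i) ; x y (inj₂ j , p) → A.refl (inj₂ j) }
  ; ker = λ x eq → (λ (i , p) → eq (inj₁ i , p)) , (λ (j , p) → eq (inj₂ j , p))
  ; surj = λ y → ((λ (i , p) → y (inj₁ i , p)) , (λ (j , p) → y (inj₂ j , p)))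
      , λ { (inj₁ i , p) → A.refl (inj₁ i) ; (inj₂ j , p) → A.refl (inj₂ j) } }
  where module A k = IsAbelianGroup (ab k)

ℤ⁺ : AbGrp
ℤ⁺ = record { Carrier = ℤ ; _≈_ = _≡_ ; _∙_ = _+_ ; ε = 0ℤ ; _⁻¹ = -_ }

ℤ⁺-isAb : IsAb ℤ⁺
ℤ⁺-isAb = ℤP.+-0-isAbelianGroup

-- Fibres of a degree function.

module _ {n : ℕ} (d : Fin (suc n) → ℤ) (q : ℤ) where
  fibre-suc-no : ¬ (d zero ≡ q) → Σ (Fin n) (λ k → d (suc k) ≡ q) ↔ Σ (Fin (suc n)) (λ k → d k ≡ q)
  fibre-suc-no d0≢q = mk↔ₛ′ (λ (k , p) → suc k , p) pred
    (λ { (zero , p) → contradiction p d0≢q ; (suc k , p) → refl }) (λ _ → refl)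
    where
    pred : Σ (Fin (suc n)) (λ k → d k ≡ q) → Σ (Fin n) (λ k → d (suc k) ≡ q)
    pred (zero  , p) = contradiction p d0≢q
    pred (suc k , p) = k , p

  fibre-suc-yes : d zero ≡ q → {m : ℕ} → Fin m ↔ Σ (Fin n) (λ k → d (suc k) ≡ q) →
    Fin (suc m) ↔ Σ (Fin (suc n)) (λ k → d k ≡ q)
  fibre-suc-yes d0≡q e = mk↔ₛ′
    (λ { zero → zero , d0≡q ; (suc i) → suc (proj₁ (e.to i)) , proj₂ (e.to i) })
    (λ { (zero , p) → zero ; (suc k , p) → suc (e.from (k , p)) })
    (λ { (zero , p) → cong (zero ,_) (uip d0≡q p)
       ; (suc k , p) → cong (λ (k , p) → suc k , p) (e.strictlyInverseˡ (k , p)) })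
    (λ { zero → refl ; (suc i) → cong suc (e.strictlyInverseʳ i) })
    where module e = Inverse e

-- Homogeneous parts are indexed by fibres, whereas the tensor computation needs an index set
-- `Fin m`. Equality proofs in ℤ are unique, so each index occurs in its fibre once.
fibre-finite : ∀ {n} (d : Fin n → ℤ) q → Σ ℕ λ m → Fin m ↔ Σ (Fin n) (λ k → d k ≡ q)
fibre-finite {zero} d q = 0 , mk↔ₛ′ (λ ()) (λ ()) (λ ()) (λ ())
fibre-finite {suc n} d q with fibre-finite (d ∘ suc) q | d zero ℤP.≟ q
... | m , e | yes p = suc m , fibre-suc-yes d q p e
... | m , e | no ¬p = m , fibre-suc-no d q ¬p ↔-∘ e

-- Tensor product with a free group of finite rank

module ℤ-Action (A : AbelianGroup 0ℓ 0ℓ) where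
  open AbelianGroup A hiding (_-_; refl) renaming (sym to ≈-sym; trans to ≈-trans)
  open AbelianGroupProperties A using (inverseˡ-unique; ⁻¹-∙-comm; ε⁻¹≈ε; identityˡ-unique)
  open CommutativeSemigroupProperties commutativeSemigroup using (interchange)
  open Mult monoid using (×-homo-+) renaming (_×_ to _ℕ·_)
  open SetoidReasoning setoid

  infixr 8 _·_

  _·_ : ℤ → Carrier → Carrier
  (+ n)    · x = n ℕ· x
  -[1+ n ] · x = (suc n ℕ· x) ⁻¹

  ⊖-· : ∀ m n x → (m ℤ.⊖ n) · x ≈ m ℕ· x ∙ (n ℕ· x) ⁻¹
  ⊖-· m       zero    x = ≈-sym (≈-trans (∙-congˡ ε⁻¹≈ε) (identityʳ _))
  ⊖-· zero    (suc n) x = ≈-sym (identityˡ _)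
  ⊖-· (suc m) (suc n) x rewrite ℤP.[1+m]⊖[1+n]≡m⊖n m n = begin
    (m ℤ.⊖ n) · x                             ≈⟨ ⊖-· m n x ⟩
    m ℕ· x ∙ (n ℕ· x) ⁻¹                      ≈⟨ identityˡ _ ⟨
    ε ∙ (m ℕ· x ∙ (n ℕ· x) ⁻¹)                ≈⟨ ∙-congʳ (inverseʳ x) ⟨
    (x ∙ x ⁻¹) ∙ (m ℕ· x ∙ (n ℕ· x) ⁻¹)       ≈⟨ interchange _ _ _ _ ⟩
    (x ∙ m ℕ· x) ∙ (x ⁻¹ ∙ (n ℕ· x) ⁻¹)       ≈⟨ ∙-congˡ (⁻¹-∙-comm _ _) ⟩
    (x ∙ m ℕ· x) ∙ (x ∙ n ℕ· x) ⁻¹            ∎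

  ·-distribʳ : ∀ x a b → (a + b) · x ≈ a · x ∙ b · x
  ·-distribʳ x (+ m)    (+ n)    = ×-homo-+ x m n
  ·-distribʳ x (+ m)    -[1+ n ] = ⊖-· m (suc n) x
  ·-distribʳ x -[1+ m ] (+ n)    = ≈-trans (⊖-· n (suc m) x) (comm _ _)
  ·-distribʳ x -[1+ m ] -[1+ n ] = begin
    (suc (suc (m ℕ.+ n)) ℕ· x) ⁻¹             ≡⟨ cong (λ k → (suc k ℕ· x) ⁻¹) (ℕP.+-suc m n) ⟨
    ((suc m ℕ.+ suc n) ℕ· x) ⁻¹               ≈⟨ ⁻¹-cong (×-homo-+ x (suc m) (suc n)) ⟩
    (suc m ℕ· x ∙ suc n ℕ· x) ⁻¹              ≈⟨ ⁻¹-∙-comm _ _ ⟨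
    (suc m ℕ· x) ⁻¹ ∙ (suc n ℕ· x) ⁻¹         ∎

  Additive : (ℤ → Carrier) → Set
  Additive F = ∀ a b → F (a + b) ≈ F a ∙ F b

  additive-0 : ∀ {F} → Additive F → F 0ℤ ≈ ε
  additive-0 add = identityˡ-unique _ _ (≈-sym (add 0ℤ 0ℤ))

  additive-neg : ∀ {F} → Additive F → ∀ a → F (- a) ≈ F a ⁻¹
  additive-neg {F} add a = inverseˡ-unique _ _ (begin
    F (- a) ∙ F a  ≈⟨ add (- a) a ⟨
    F (- a + a)    ≡⟨ cong F (ℤP.+-inverseˡ a) ⟩
    F 0ℤ           ≈⟨ additive-0 add ⟩
    ε              ∎)

  -- A homomorphism out of ℤ is determined by its value at 1. The remaining scalar laws, and the
  -- passage of scalars across a tensor sign, reduce to this.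
  additive-ext : ∀ {F F'} → Additive F → Additive F' → F 1ℤ ≈ F' 1ℤ → ∀ a → F a ≈ F' a
  additive-ext {F} {F'} add add' F1≈F'1 = λ { (+ n) → pos n ; -[1+ n ] → begin
      F -[1+ n ]        ≈⟨ additive-neg add (+ suc n) ⟩
      F (+ suc n) ⁻¹    ≈⟨ ⁻¹-cong (pos (suc n)) ⟩
      F' (+ suc n) ⁻¹   ≈⟨ additive-neg add' (+ suc n) ⟨
      F' -[1+ n ]       ∎ }
    where
    pos : ∀ n → F (+ n) ≈ F' (+ n)
    pos zero    = ≈-trans (additive-0 add) (≈-sym (additive-0 add'))
    pos (suc n) = begin
      F (1ℤ + + n)        ≈⟨ add 1ℤ (+ n) ⟩
      F 1ℤ ∙ F (+ n)      ≈⟨ ∙-cong F1≈F'1 (pos n) ⟩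
      F' 1ℤ ∙ F' (+ n)    ≈⟨ add' 1ℤ (+ n) ⟨
      F' (1ℤ + + n)       ∎

  additive⇒· : ∀ {F} → Additive F → ∀ a → F a ≈ a · F 1ℤ
  additive⇒· {F} add = additive-ext add (·-distribʳ (F 1ℤ)) (≈-sym (identityʳ _))

  ·-congˡ : ∀ a {x y} → x ≈ y → a · x ≈ a · y
  ·-congˡ a {x} {y} x≈y = additive-ext (·-distribʳ x) (·-distribʳ y) (∙-congʳ x≈y) a

  ·-distribˡ : ∀ a x y → a · (x ∙ y) ≈ a · x ∙ a · y
  ·-distribˡ a x y = ≈-sym (≈-trans
    (additive⇒· {λ a → a · x ∙ a · y} (λ a b → begin
      (a + b) · x ∙ (a + b) · y            ≈⟨ ∙-cong (·-distribʳ x a b) (·-distribʳ y a b) ⟩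
      (a · x ∙ b · x) ∙ (a · y ∙ b · y)    ≈⟨ interchange _ _ _ _ ⟩
      (a · x ∙ a · y) ∙ (b · x ∙ b · y)    ∎) a)
    (·-congˡ a (∙-cong (identityʳ x) (identityʳ y))))

module TensorProperties {G H : AbGrp} (abG : IsAb G) (abH : IsAb H) where
  open Tensor G H
  private
    module G = AbelianGroup (bundle G abG)
    module H = AbelianGroup (bundle H abH)

  ∼-isEquivalence : IsEquivalence _∼_
  ∼-isEquivalence = record { refl = ∼refl ; sym = ∼sym ; trans = ∼trans }

  private
    ∼-setoid : Setoid 0ℓ 0ℓ
    ∼-setoid = record { isEquivalence = ∼-isEquivalence }
    open SetoidReasoning ∼-setoid

  neg : List (∣ G ∣ × ∣ H ∣) → List (∣ G ∣ × ∣ H ∣)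
  neg = map (λ p → proj₁ p G.⁻¹ , proj₂ p)

  ∷∼∷ʳ : ∀ p ys → (p ∷ ys) ∼ (ys ++ p ∷ [])
  ∷∼∷ʳ p []       = ∼refl
  ∷∼∷ʳ p (y ∷ ys) = ∼trans (∼++ (∼swap {p} {y}) (∼refl {ys})) (∼++ (∼refl {y ∷ []}) (∷∼∷ʳ p ys))

  ++-comm-∼ : ∀ xs ys → (xs ++ ys) ∼ (ys ++ xs)
  ++-comm-∼ []       ys rewrite ListP.++-identityʳ ys = ∼refl
  ++-comm-∼ (x ∷ xs) ys = begin
    x ∷ xs ++ ys            ≈⟨ ∼++ (∼refl {x ∷ []}) (++-comm-∼ xs ys) ⟩
    x ∷ ys ++ xs            ≈⟨ ∼++ (∷∼∷ʳ x ys) (∼refl {xs}) ⟩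
    (ys ++ x ∷ []) ++ xs    ≡⟨ ListP.++-assoc ys (x ∷ []) xs ⟩
    ys ++ x ∷ xs            ∎

  neg-inverseˡ : ∀ xs → (neg xs ++ xs) ∼ []
  neg-inverseˡ []             = ∼refl
  neg-inverseˡ ((g , h) ∷ xs) = begin
    (g G.⁻¹ , h) ∷ neg xs ++ (g , h) ∷ xs       ≈⟨ ∼++ (∼refl {(g G.⁻¹ , h) ∷ []}) (++-comm-∼ (neg xs) _) ⟩
    (g G.⁻¹ , h) ∷ (g , h) ∷ xs ++ neg xs       ≈⟨ ∼++ (∼sym ∼linˡ) (++-comm-∼ xs (neg xs)) ⟩
    (g G.⁻¹ G.∙ g , h) ∷ neg xs ++ xs           ≈⟨ ∼++ (∼resp (G.inverseˡ g) H.refl) (neg-inverseˡ xs) ⟩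
    (G.ε , h) ∷ []                              ≈⟨ ∼zero ⟩
    []                                          ∎

  -- No constructor of `_∼_` mentions `neg`; the claim is the uniqueness of inverses, obtained by
  -- inserting `neg ys ++ ys` and exchanging `ys` for `xs`.
  neg-cong : ∀ {xs ys} → xs ∼ ys → neg xs ∼ neg ys
  neg-cong {xs} {ys} xs∼ys = begin
    neg xs                        ≡⟨ ListP.++-identityʳ (neg xs) ⟨
    neg xs ++ []                  ≈⟨ ∼++ (∼refl {neg xs}) (neg-inverseˡ ys) ⟨
    neg xs ++ (neg ys ++ ys)      ≈⟨ ∼++ (∼refl {neg xs}) (++-comm-∼ (neg ys) ys) ⟩
    neg xs ++ (ys ++ neg ys)      ≡⟨ ListP.++-assoc (neg xs) ys (neg ys) ⟨
    (neg xs ++ ys) ++ neg ys      ≈⟨ ∼++ (∼++ (∼refl {neg xs}) xs∼ys) (∼refl {neg ys}) ⟨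
    (neg xs ++ xs) ++ neg ys      ≈⟨ ∼++ (neg-inverseˡ xs) (∼refl {neg ys}) ⟩
    neg ys                        ∎

  ⊗-isAb : IsAb (G ⊗ H)
  ⊗-isAb = mkIsAb (G ⊗ H) ∼-isEquivalence ∼++
    (λ x y z → IsEquivalence.reflexive ∼-isEquivalence (ListP.++-assoc x y z))
    (λ x → ∼refl) neg-inverseˡ neg-cong ++-comm-∼

open TensorProperties using (⊗-isAb)

δ : ∀ {n} → Fin n → Fin n → ℤ
δ zero    zero    = 1ℤ
δ zero    (suc j) = 0ℤ
δ (suc i) zero    = 0ℤ
δ (suc i) (suc j) = δ i j

module TensorFree {G H : AbGrp} {m : ℕ} (abG : IsAb G) (φ : Iso H (Π (Fin m) (λ _ → ℤ⁺))) where
  private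
    module φ = IsoProperties φ
    abH = φ.abˡ
    abT = ⊗-isAb abG abH
    module G = AbelianGroup (bundle G abG)
    module H = AbelianGroup (bundle H abH)
    module GA = ℤ-Action (bundle G abG)
    module HA = ℤ-Action (bundle H abH)
    module ZA = ℤ-Action (bundle ℤ⁺ ℤ⁺-isAb)
    module TA = ℤ-Action (bundle (G ⊗ H) abT)
    module GP = AbelianGroupProperties (bundle G abG)
    open CommutativeSemigroupProperties G.commutativeSemigroup using (interchange; x∙yz≈y∙xz)
    open GA using (_·_)
    open Tensor G H
    open TensorProperties abG abH

    -- With H ≅ ℤ^m, this is the isomorphism G ⊗ ℤ^m ≅ G^m, sending g ⊗ h to the tuple of the h_i ·
    -- g. Its inverse sends f to the sum of the f i ⊗ e i.
    coords : List (∣ G ∣ × ∣ H ∣) → Fin m → ∣ G ∣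
    coords []             i = G.ε
    coords ((g , h) ∷ xs) i = φ.to h i · g G.∙ coords xs i

    coords-++ : ∀ xs ys i → coords (xs ++ ys) i G.≈ coords xs i G.∙ coords ys i
    coords-++ []             ys i = G.sym (G.identityˡ _)
    coords-++ ((g , h) ∷ xs) ys i = G.trans (G.∙-congˡ (coords-++ xs ys i)) (G.sym (G.assoc _ _ _))

    coords-cong : ∀ {xs ys} → xs ∼ ys → ∀ i → coords xs i G.≈ coords ys i
    coords-cong ∼refl i = G.refl
    coords-cong (∼sym p) i = G.sym (coords-cong p i)
    coords-cong (∼trans p q) i = G.trans (coords-cong p i) (coords-cong q i)
    coords-cong (∼++ {xs} {xs'} {ys} {ys'} p q) i = G.trans (coords-++ xs ys i)
      (G.trans (G.∙-cong (coords-cong p i) (coords-cong q i)) (G.sym (coords-++ xs' ys' i)))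
    coords-cong ∼swap i = x∙yz≈y∙xz _ _ _
    coords-cong (∼resp {a} {a'} {b} {b'} p q) i = G.∙-congʳ (G.trans
      (GA.·-congˡ (φ.to b i) p) (G.reflexive (cong (_· a') (φ.≈-cong q i))))
    coords-cong (∼linˡ {a} {a'} {b}) i = G.trans (G.∙-congʳ (GA.·-distribˡ (φ.to b i) a a')) (G.assoc _ _ _)
    coords-cong (∼linʳ {a} {b} {b'}) i = G.trans (G.∙-congʳ (G.trans
      (G.reflexive (cong (_· a) (φ.homo b b' i))) (GA.·-distribʳ a (φ.to b i) (φ.to b' i)))) (G.assoc _ _ _)
    coords-cong (∼zero {b}) i = G.trans (G.identityʳ _) (GP.identityˡ-unique _ _
      (G.trans (G.sym (GA.·-distribˡ (φ.to b i) G.ε G.ε)) (GA.·-congˡ (φ.to b i) (G.identityˡ _))))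

    e : Fin m → ∣ H ∣
    e i = φ.from (δ i)

    combination : ∀ n → (Fin n → ∣ G ∣) → (Fin n → ∣ H ∣) → List (∣ G ∣ × ∣ H ∣)
    combination zero    g h = []
    combination (suc n) g h = (g zero , h zero) ∷ combination n (g ∘ suc) (h ∘ suc)

    coords-off : ∀ {n} g (h : Fin n → ∣ H ∣) j → (∀ i → φ.to (h i) j ≡ 0ℤ) →
      coords (combination n g h) j G.≈ G.ε
    coords-off {zero}  g h j h0 = G.refl
    coords-off {suc n} g h j h0 rewrite h0 zero =
      G.trans (G.identityˡ _) (coords-off (g ∘ suc) (h ∘ suc) j (h0 ∘ suc))

    -- The position `k` in the family is kept apart from the coordinate `j`, because the induction
    -- shortens the family while the rank `m` stays fixed.
    coords-δ : ∀ {n} g (h : Fin n → ∣ H ∣) j k → (∀ i → φ.to (h i) j ≡ δ i k) →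
      coords (combination n g h) j G.≈ g k
    coords-δ g h j zero hδ rewrite hδ zero = G.trans
      (G.∙-cong (G.identityʳ _) (coords-off (g ∘ suc) (h ∘ suc) j (hδ ∘ suc))) (G.identityʳ _)
    coords-δ g h j (suc k) hδ rewrite hδ zero =
      G.trans (G.identityˡ _) (coords-δ (g ∘ suc) (h ∘ suc) j k (hδ ∘ suc))

    ΣH : ∀ n → (Fin n → ℤ) → (Fin n → ∣ H ∣) → ∣ H ∣
    ΣH zero    c h = H.ε
    ΣH (suc n) c h = c zero HA.· h zero H.∙ ΣH n (c ∘ suc) (h ∘ suc)

    to-· : ∀ a h j → φ.to (a HA.· h) j ≡ a * φ.to h j
    to-· a h j = ZA.additive-ext
      (λ a b → trans (φ.≈-cong (HA.·-distribʳ h a b) j) (φ.homo _ _ j))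
      (ℤP.*-distribʳ-+ (φ.to h j))
      (trans (φ.≈-cong (H.identityʳ h) j) (sym (ℤP.*-identityˡ _))) a

    to-Σ-off : ∀ {n} c (h : Fin n → ∣ H ∣) j → (∀ i → φ.to (h i) j ≡ 0ℤ) → φ.to (ΣH n c h) j ≡ 0ℤ
    to-Σ-off {zero}  c h j h0 = φ.to-ε j
    to-Σ-off {suc n} c h j h0 = trans (φ.homo _ _ j) (cong₂ _+_
      (trans (to-· (c zero) _ j) (trans (cong (c zero *_) (h0 zero)) (ℤP.*-zeroʳ (c zero))))
      (to-Σ-off (c ∘ suc) (h ∘ suc) j (h0 ∘ suc)))

    to-Σ-δ : ∀ {n} c (h : Fin n → ∣ H ∣) j k → (∀ i → φ.to (h i) j ≡ δ i k) → φ.to (ΣH n c h) j ≡ c k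
    to-Σ-δ c h j zero hδ = trans (φ.homo _ _ j) (trans (cong₂ _+_
      (trans (to-· (c zero) _ j) (trans (cong (c zero *_) (hδ zero)) (ℤP.*-identityʳ (c zero))))
      (to-Σ-off (c ∘ suc) (h ∘ suc) j (hδ ∘ suc))) (ℤP.+-identityʳ (c zero)))
    to-Σ-δ c h j (suc k) hδ = trans (φ.homo _ _ j) (trans (cong₂ _+_
      (trans (to-· (c zero) _ j) (trans (cong (c zero *_) (hδ zero)) (ℤP.*-zeroʳ (c zero))))
      (to-Σ-δ (c ∘ suc) (h ∘ suc) j k (hδ ∘ suc))) (ℤP.+-identityˡ _))

    expand : ∀ h → h H.≈ ΣH m (φ.to h) e
    expand h = φ.injective (λ j → sym (to-Σ-δ (φ.to h) e j j (λ i → φ.to-from (δ i) j)))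

    -- Both sides are additive in `a` and agree at 1, so `additive-ext` applies inside the tensor
    -- product.
    ·-swap : ∀ a g h → ((g , a HA.· h) ∷ []) ∼ ((a · g , h) ∷ [])
    ·-swap a g h = TA.additive-ext
      {λ a → (g , a HA.· h) ∷ []} {λ a → (a · g , h) ∷ []}
      (λ a b → ∼trans (∼resp G.refl (HA.·-distribʳ h a b)) ∼linʳ)
      (λ a b → ∼trans (∼resp (GA.·-distribʳ g a b) H.refl) ∼linˡ)
      (∼resp (G.sym (G.identityʳ g)) (H.identityʳ h)) a

    -- Only the left-hand version is a generator of `_∼_`. By `∼linʳ` the element g ⊗ 0 equals its
    -- own double, so it vanishes.
    pure-ε : ∀ g → ((g , H.ε) ∷ []) ∼ []
    pure-ε g = TP.identityˡ-unique _ _ (∼trans (∼sym (∼linʳ {g} {H.ε} {H.ε})) (∼resp G.refl (H.identityˡ _)))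
      where module TP = AbelianGroupProperties (bundle (G ⊗ H) abT)

    pure-Σ : ∀ n g c h → ((g , ΣH n c h) ∷ []) ∼ combination n (λ i → c i · g) h
    pure-Σ zero    g c h = pure-ε g
    pure-Σ (suc n) g c h = ∼trans ∼linʳ
      (∼++ (·-swap (c zero) g (h zero)) (pure-Σ n g (c ∘ suc) (h ∘ suc)))

    combination-ε : ∀ n g h → (∀ i → g i G.≈ G.ε) → combination n g h ∼ []
    combination-ε zero    g h g≈ε = ∼refl
    combination-ε (suc n) g h g≈ε =
      ∼++ (∼trans (∼resp (g≈ε zero) H.refl) ∼zero) (combination-ε n (g ∘ suc) (h ∘ suc) (g≈ε ∘ suc))

    combination-∙ : ∀ n g g' h →
      (combination n g h ++ combination n g' h) ∼ combination n (λ i → g i G.∙ g' i) h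
    combination-∙ zero    g g' h = ∼refl
    combination-∙ (suc n) g g' h =
      ∼trans (∼++ (∼refl {(g zero , h zero) ∷ []}) (∼trans
        (++-comm-∼ (combination n (g ∘ suc) (h ∘ suc)) _)
        (∼++ (∼refl {(g' zero , h zero) ∷ []})
          (++-comm-∼ (combination n (g' ∘ suc) (h ∘ suc)) (combination n (g ∘ suc) (h ∘ suc))))))
      (∼++ (∼sym ∼linˡ) (combination-∙ n (g ∘ suc) (g' ∘ suc) (h ∘ suc)))

    -- The source of injectivity: expanding each second factor in the basis `e`, moving the scalars
    -- to the left and collecting terms shows that the coordinates determine the class of a formal
    -- sum.
    normal-form : ∀ xs → xs ∼ combination m (coords xs) e
    normal-form []             = ∼sym (combination-ε m _ e (λ _ → G.refl))
    normal-form ((g , h) ∷ xs) = ∼trans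
      (∼++ (∼trans (∼resp G.refl (expand h)) (pure-Σ m g (φ.to h) e)) (normal-form xs))
      (combination-∙ m _ _ e)

  ⊗-free : Iso (G ⊗ H) (Π (Fin m) (λ _ → G))
  ⊗-free = record
    { abˡ = abT ; abʳ = Π-isAb (λ _ → abG) ; to = coords ; ≈-cong = coords-cong ; homo = coords-++
    ; ker = λ xs eq → ∼trans (normal-form xs) (combination-ε m _ e eq)
    ; surj = λ f → combination m f e , λ j → coords-δ f e j j (λ i → φ.to-from (δ i) j) }

⊗-free-fibre : {G H : AbGrp} {n : ℕ} (d : Fin n → ℤ) (q : ℤ) → IsAb G →
  Iso H (Π (Σ (Fin n) (λ k → d k ≡ q)) (λ _ → ℤ⁺)) →
  Iso (G ⊗ H) (Π (Σ (Fin n) (λ k → d k ≡ q)) (λ _ → G))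
⊗-free-fibre d q abG φ with fibre-finite d q
... | m , e = Iso-trans (TensorFree.⊗-free abG (Iso-trans φ (Π-reindex ℤ⁺-isAb e)))
                        (Iso-sym (Π-reindex abG e))

-- Homology of id ⊗ d ⊗ ρ for a split injection ρ

open FMod using (deg)

degree : (M : FMod) → Fin (rk M) → ℤ
degree M k = deg M (basis M k)

Coef : FMod → FMod → Set
Coef M₁ M₂ = FMod.B M₁ → FMod.B M₂ → ℤ

-- Finite sums, maps in coordinates and subquotients.

Σℤ-*ˡ : ∀ n a (f : Fin n → ℤ) → a * Σℤ n f ≡ Σℤ n (λ k → a * f k)
Σℤ-*ˡ zero    a f = ℤP.*-zeroʳ a
Σℤ-*ˡ (suc n) a f = trans (ℤP.*-distribˡ-+ a (f zero) _) (cong (_+_ (a * f zero)) (Σℤ-*ˡ n a (f ∘ suc)))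

Σℤ-swap : ∀ m n (f : Fin m → Fin n → ℤ) →
  Σℤ m (λ i → Σℤ n (λ j → f i j)) ≡ Σℤ n (λ j → Σℤ m (λ i → f i j))
Σℤ-swap zero    n f = sym (Σℤ-0 n _ (λ _ → refl))
Σℤ-swap (suc m) n f = trans (cong (_+_ (Σℤ n (f zero))) (Σℤ-swap m n (f ∘ suc))) (sym (Σℤ-+ n _ _))

module _ (M₁ M₂ : FMod) (c : Coef M₁ M₂) where
  app-cong : ∀ {x y} → x ≋ y → ∀ t → app M₁ M₂ c x t ≡ app M₁ M₂ c y t
  app-cong x≋y t = Σℤ-cong (rk M₁) _ _ (λ s → cong (c (basis M₁ s) (basis M₂ t) *_) (x≋y s))

  app-≋0 : ∀ {x} → x ≋ zeroV → ∀ t → app M₁ M₂ c x t ≡ 0ℤ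
  app-≋0 x≋0 t = trans (app-cong x≋0 t) (app-0 M₁ M₂ c t)

  app-minus : ∀ x y t → app M₁ M₂ c (λ k → x k - y k) t ≡ app M₁ M₂ c x t - app M₁ M₂ c y t
  app-minus x y t = trans (app-+ M₁ M₂ c x (λ k → - y k) t)
    (cong (_+_ (app M₁ M₂ c x t)) (app-neg M₁ M₂ c y t))

-- The maps c ⊗ id and id ⊗ c' commute because they act on different indices of `Z`. This lets the
-- Khovanov differential pass through `Δ̄`.
app-comm : ∀ M₁ M₂ c M₁' M₂' c' (Z : Fin (rk M₁') → El M₁) t t' →
  app M₁ M₂ c (λ s → app M₁' M₂' c' (λ k → Z k s) t') t
    ≡ app M₁' M₂' c' (λ k → app M₁ M₂ c (Z k) t) t'
app-comm M₁ M₂ c M₁' M₂' c' Z t t' = begin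
  Σℤ m (λ s → a s * Σℤ n (λ k → b k * Z k s))    ≡⟨ Σℤ-cong m _ _ (λ s → Σℤ-*ˡ n (a s) _) ⟩
  Σℤ m (λ s → Σℤ n (λ k → a s * (b k * Z k s)))  ≡⟨ Σℤ-swap m n _ ⟩
  Σℤ n (λ k → Σℤ m (λ s → a s * (b k * Z k s)))
    ≡⟨ Σℤ-cong n _ _ (λ k → Σℤ-cong m _ _ (λ s → exchange (a s) (b k) (Z k s))) ⟩
  Σℤ n (λ k → Σℤ m (λ s → b k * (a s * Z k s)))  ≡⟨ Σℤ-cong n _ _ (λ k → sym (Σℤ-*ˡ m (b k) _)) ⟩
  Σℤ n (λ k → b k * Σℤ m (λ s → a s * Z k s))    ∎
  where
  open ≡-Reasoning
  m = rk M₁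
  n = rk M₁'
  a : Fin m → ℤ
  a s = c (basis M₁ s) (basis M₂ t)
  b : Fin n → ℤ
  b k = c' (basis M₁' k) (basis M₂' t')
  exchange : ∀ x y z → x * (y * z) ≡ y * (x * z)
  exchange = solve-∀

private
  a-a≡0 : ∀ a → a - a ≡ 0ℤ
  a-a≡0 = solve-∀

module _ (M₀ M₁ M₂ : FMod) (c₀ : Coef M₀ M₁) (c₁ : Coef M₁ M₂) (j : ℤ) where
  private
    G = SQ M₀ M₁ M₂ c₀ c₁ j
    open RawGroup G

  SQ-≋⇒≈ : {x y : ∣ G ∣} → proj₁ x ≋ proj₁ y → x ≈ y
  SQ-≋⇒≈ {x} {y} x≋y = zeroV , (λ _ _ → refl) , λ k →
    trans (cong (_- proj₁ y k) (x≋y k)) (trans (a-a≡0 (proj₁ y k)) (sym (app-0 M₀ M₁ c₀ k)))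

  SQ-isAb : IsAb G
  SQ-isAb = mkIsAb G
    (record
      { refl  = λ {x} → SQ-≋⇒≈ {x} {x} (λ _ → refl)
      ; sym   = λ {x} {y} (z , hz , eq) → (λ k → - z k) , (λ k ne → cong -_ (hz k ne))
          , λ k → trans (flip-minus (proj₁ x k) (proj₁ y k))
              (trans (cong -_ (eq k)) (sym (app-neg M₀ M₁ c₀ z k)))
      ; trans = λ {x} {y} {w} (z , hz , eq) (z' , hz' , eq') → (λ k → z k + z' k)
          , (λ k ne → cong₂ _+_ (hz k ne) (hz' k ne))
          , λ k → trans (telescope (proj₁ x k) (proj₁ y k) (proj₁ w k))
              (trans (cong₂ _+_ (eq k) (eq' k)) (sym (app-+ M₀ M₁ c₀ z z' k))) })
    (λ {x} {y} {u} {v} (z , hz , eq) (z' , hz' , eq') → (λ k → z k + z' k)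
      , (λ k ne → cong₂ _+_ (hz k ne) (hz' k ne))
      , λ k → trans (regroup (proj₁ x k) (proj₁ y k) (proj₁ u k) (proj₁ v k))
          (trans (cong₂ _+_ (eq k) (eq' k)) (sym (app-+ M₀ M₁ c₀ z z' k))))
    (λ x y z → SQ-≋⇒≈ {(x ∙ y) ∙ z} {x ∙ (y ∙ z)} (λ k → ℤP.+-assoc (proj₁ x k) _ _))
    (λ x → SQ-≋⇒≈ {ε ∙ x} {x} (λ k → ℤP.+-identityˡ (proj₁ x k)))
    (λ x → SQ-≋⇒≈ {(x ⁻¹) ∙ x} {ε} (λ k → ℤP.+-inverseˡ (proj₁ x k)))
    (λ {x} {y} (z , hz , eq) → (λ k → - z k) , (λ k ne → cong -_ (hz k ne))
      , λ k → trans (neg-minus (proj₁ x k) (proj₁ y k))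
          (trans (cong -_ (eq k)) (sym (app-neg M₀ M₁ c₀ z k))))
    (λ x y → SQ-≋⇒≈ {x ∙ y} {y ∙ x} (λ k → ℤP.+-comm (proj₁ x k) _))
    where
    flip-minus : ∀ a b → b - a ≡ - (a - b)
    flip-minus = solve-∀
    telescope : ∀ a b c → a - c ≡ (a - b) + (b - c)
    telescope = solve-∀
    regroup : ∀ a b c d → (a + c) - (b + d) ≡ (a - b) + (c - d)
    regroup = solve-∀
    neg-minus : ∀ a b → - a - - b ≡ - (a - b)
    neg-minus = solve-∀

Img-isAb : ∀ M₀ M₁ c j → IsAb (Img M₀ M₁ c j)
Img-isAb M₀ M₁ c j = mkIsAb (Img M₀ M₁ c j)
  (record { refl = λ _ → refl ; sym = λ p k → sym (p k) ; trans = λ p q k → trans (p k) (q k) })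
  (λ p q k → cong₂ _+_ (p k) (q k))
  (λ x y z k → ℤP.+-assoc (proj₁ x k) _ _)
  (λ x k → ℤP.+-identityˡ _)
  (λ x k → ℤP.+-inverseˡ (proj₁ x k))
  (λ p k → cong -_ (p k))
  (λ x y k → ℤP.+-comm (proj₁ x k) _)

module _ {n : ℕ} (d : Fin n → ℤ) (q : ℤ) where
  extend : (Σ (Fin n) (λ k → d k ≡ q) → ℤ) → Fin n → ℤ
  extend f k with d k ℤP.≟ q
  ... | yes p = f (k , p)
  ... | no _  = 0ℤ

  extend-on : ∀ f k p → extend f k ≡ f (k , p)
  extend-on f k p with d k ℤP.≟ q
  ... | yes p' = cong (λ p → f (k , p)) (uip p' p)
  ... | no ¬p  = contradiction p ¬p

  extend-off : ∀ f k → ¬ (d k ≡ q) → extend f k ≡ 0ℤ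
  extend-off f k ¬p with d k ℤP.≟ q
  ... | yes p = contradiction p ¬p
  ... | no _  = refl

-- The map c : M₀ → M₁ is injective onto a graded direct summand: in the basis of M₁ the
-- coordinates ι recover the preimage, and the coordinates κ span a complement.
record Split (M₀ M₁ : FMod) (c : Coef M₀ M₁) : Set where
  field
    N         : ℕ
    ι⊎κ       : (Fin (rk M₀) ⊎ Fin N) ↔ Fin (rk M₁)
  open Inverse ι⊎κ public using () renaming (to to place; from to locate)
  ι : Fin (rk M₀) → Fin (rk M₁)
  ι = place ∘ inj₁
  κ : Fin N → Fin (rk M₁)
  κ = place ∘ inj₂
  field
    degree-ι  : ∀ s → degree M₁ (ι s) ≡ degree M₀ s
    retract   : ∀ x s → app M₀ M₁ c x (ι s) ≡ x s
    app-Homog : ∀ {j x} → Homog M₀ j x → Homog M₁ j (app M₀ M₁ c x)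

  byCases : (P : Fin (rk M₁) → Set) → (∀ s → P (ι s)) → (∀ t → P (κ t)) → ∀ t → P t
  byCases P pι pκ t = subst P (Inverse.strictlyInverseˡ ι⊎κ t) ([_,_] {C = P ∘ place} pι pκ (locate t))

  glue : (Fin (rk M₀) → ℤ) → (Fin N → ℤ) → El M₁
  glue f g = [ f , g ] ∘ locate

  glue-ι : ∀ f g s → glue f g (ι s) ≡ f s
  glue-ι f g s = cong [ f , g ] (Inverse.strictlyInverseʳ ι⊎κ (inj₁ s))

  glue-κ : ∀ f g t → glue f g (κ t) ≡ g t
  glue-κ f g t = cong [ f , g ] (Inverse.strictlyInverseʳ ι⊎κ (inj₂ t))

  -- Projection onto the complement along the image. By `retract`, the only image element with the
  -- `ι`-coordinates of `y` is `app M₀ M₁ c (y ∘ ι)`; after subtracting it only `κ`-coordinates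
  -- remain, and all of them vanish exactly when `y` lies in the image.
  residue : El M₁ → Fin N → ℤ
  residue y t = y (κ t) - app M₀ M₁ c (y ∘ ι) (κ t)

  residue-+ : ∀ x y t → residue (λ k → x k + y k) t ≡ residue x t + residue y t
  residue-+ x y t = trans (cong (_-_ (x (κ t) + y (κ t))) (app-+ M₀ M₁ c (x ∘ ι) (y ∘ ι) (κ t)))
    (regroup (x (κ t)) (y (κ t)) _ _)
    where
    regroup : ∀ a b c d → (a + b) - (c + d) ≡ (a - c) + (b - d)
    regroup = solve-∀

  residue-minus : ∀ x y t → residue (λ k → x k - y k) t ≡ residue x t - residue y t
  residue-minus x y t = trans (cong (_-_ (x (κ t) - y (κ t))) (app-minus M₀ M₁ c (x ∘ ι) (y ∘ ι) (κ t)))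
    (regroup (x (κ t)) (y (κ t)) _ _)
    where
    regroup : ∀ a b c d → (a - b) - (c - d) ≡ (a - c) - (b - d)
    regroup = solve-∀

  residue-app : ∀ {y} z → y ≋ app M₀ M₁ c z → ∀ t → residue y t ≡ 0ℤ
  residue-app z y≋ t = trans (cong₂ _-_ (y≋ (κ t))
    (app-cong M₀ M₁ c (λ s → trans (y≋ (ι s)) (retract z s)) (κ t))) (a-a≡0 (app M₀ M₁ c z (κ t)))

  residue-glue : ∀ f g t → residue (glue f g) t ≡ g t - app M₀ M₁ c f (κ t)
  residue-glue f g t = cong₂ _-_ (glue-κ f g t) (app-cong M₀ M₁ c (glue-ι f g) (κ t))

  residue≡0 : ∀ {y} t → residue y t ≡ 0ℤ → y (κ t) ≡ app M₀ M₁ c (y ∘ ι) (κ t)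
  residue≡0 t = ℤP.i-j≡0⇒i≡j _ _

  Homog-ι : ∀ {j y} → Homog M₁ j y → Homog M₀ j (y ∘ ι)
  Homog-ι hy s ne = hy (ι s) (ne ∘ trans (sym (degree-ι s)))

  residue-Homog : ∀ {j y} → Homog M₁ j y → ∀ t → ¬ (degree M₁ (κ t) ≡ j) → residue y t ≡ 0ℤ
  residue-Homog hy t ne = cong₂ _-_ (hy (κ t) ne) (app-Homog (Homog-ι hy) (κ t) ne)

  -- By `retract`, the `ι`-coordinates of an image element are its preimage, so they determine it,
  -- and those of degree `q` can be prescribed freely.
  Img-free : ∀ q → Iso (Img M₀ M₁ c q) (Π (Σ (Fin (rk M₀)) (λ s → degree M₀ s ≡ q)) (λ _ → ℤ⁺))
  Img-free q = record
    { abˡ = Img-isAb M₀ M₁ c q ; abʳ = Π-isAb (λ _ → ℤ⁺-isAb)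
    ; to = λ { (y , _) (s , _) → y (ι s) }
    ; ≈-cong = λ eq (s , _) → eq (ι s)
    ; homo = λ _ _ _ → refl
    ; ker = λ { (y , _ , x , hx , eq) y≡0 k → trans (sym (eq k))
        (app-≋0 M₀ M₁ c (λ s → vanish x hx s (λ p → trans (sym (retract x s)) (trans (eq (ι s)) (y≡0 (s , p))))) k) }
    ; surj = λ f →
        let x = extend (degree M₀) q f ; hx = extend-off (degree M₀) q f
        in (app M₀ M₁ c x , app-Homog hx , x , hx , λ _ → refl)
           , λ (s , p) → trans (retract x s) (extend-on (degree M₀) q f s p) }
    where
    vanish : ∀ x → Homog M₀ q x → ∀ s → (degree M₀ s ≡ q → x s ≡ 0ℤ) → x s ≡ 0ℤ
    vanish x hx s x≡0 with degree M₀ s ℤP.≟ q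
    ... | yes p = x≡0 p
    ... | no ne = hx s ne

  -- `residue` induces the isomorphism: its kernel is the image, and an element supported on the
  -- `κ`-coordinates has those coordinates as its residue.
  Coker-free : ∀ q → Iso (SQ M₀ M₁ Zero c (λ _ _ → 0ℤ) q)
                         (Π (Σ (Fin N) (λ t → degree M₁ (κ t) ≡ q)) (λ _ → ℤ⁺))
  Coker-free q = record
    { abˡ = SQ-isAb M₀ M₁ Zero c (λ _ _ → 0ℤ) q ; abʳ = Π-isAb (λ _ → ℤ⁺-isAb)
    ; to = λ { (y , _) (t , _) → residue y t }
    ; ≈-cong = λ { {x , _} {y , _} (z , _ , eq) (t , _) →
        ℤP.i-j≡0⇒i≡j _ _ (trans (sym (residue-minus x y t)) (residue-app z eq t)) }
    ; homo = λ { (x , _) (y , _) (t , _) → residue-+ x y t }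
    ; ker = λ { (y , hy , _) y≡0 → y ∘ ι , Homog-ι hy , λ k → trans (ℤP.+-identityʳ (y k))
        (byCases (λ k → y k ≡ app M₀ M₁ c (y ∘ ι) k) (λ s → sym (retract (y ∘ ι) s))
          (λ t → residue≡0 {y} t (vanish y hy t (λ p → y≡0 (t , p)))) k) }
    ; surj = λ f →
        let g = extend (degree M₁ ∘ κ) q f ; y = glue (λ _ → 0ℤ) g
        in (y , byCases (λ k → ¬ (degree M₁ k ≡ q) → y k ≡ 0ℤ) (λ s _ → glue-ι _ g s)
                  (λ t ne → trans (glue-κ _ g t) (extend-off (degree M₁ ∘ κ) q f t ne))
              , λ ())
           , λ (t , p) → trans (residue-glue (λ _ → 0ℤ) g t) (trans
               (cong₂ _-_ (extend-on (degree M₁ ∘ κ) q f t p) (app-0 M₀ M₁ c (κ t)))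
               (ℤP.+-identityʳ _)) }
    where
    vanish : ∀ y → Homog M₁ q y → ∀ t → (degree M₁ (κ t) ≡ q → residue y t ≡ 0ℤ) → residue y t ≡ 0ℤ
    vanish y hy t r≡0 with degree M₁ (κ t) ℤP.≟ q
    ... | yes p = r≡0 p
    ... | no ne = residue-Homog hy t ne

-- With zero source all of `M` is complement, so `Coker-free` also computes the homogeneous parts of
-- a free module, in particular `V⊗deg`.
Zero-split : ∀ M → Split Zero M (λ _ _ → 0ℤ)
Zero-split M = record
  { N = rk M
  ; ι⊎κ = mk↔ₛ′ (λ { (inj₁ ()) ; (inj₂ t) → t }) inj₂ (λ _ → refl) (λ { (inj₁ ()) ; (inj₂ _) → refl })
  ; degree-ι = λ () ; retract = λ _ () ; app-Homog = λ _ _ _ → refl }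

-- A graded isomorphism V ⊗ K ⊗ R ≅ C that matches bases, expressed through basis indices so that no
-- tensor product of `FMod` has to be formed.
record Decomposition (V C K R : FMod) : Set where
  field
    triple     : (Fin (rk V) × Fin (rk K) × Fin (rk R)) ↔ Fin (rk C)
  open Inverse triple public using () renaming (to to enc; from to dec)
  field
    degree-enc : ∀ u k r → degree C (enc (u , k , r)) ≡ degree V u + degree K k + degree R r

  slice : El C → Fin (rk V) → Fin (rk K) → Fin (rk R) → ℤ
  slice x u k r = x (enc (u , k , r))

  build : (Fin (rk V) → Fin (rk K) → Fin (rk R) → ℤ) → El C
  build X s = let (u , k , r) = dec s in X u k r

  slice-build : ∀ X u k r → slice (build X) u k r ≡ X u k r
  slice-build X u k r = cong (λ (u , k , r) → X u k r) (Inverse.strictlyInverseʳ triple (u , k , r))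

  bySlices : (P : Fin (rk C) → Set) → (∀ u k r → P (enc (u , k , r))) → ∀ s → P s
  bySlices P p s = subst P (Inverse.strictlyInverseˡ triple s) (let (u , k , r) = dec s in p u k r)

  slice-Homogᴷ : ∀ {j x} → Homog C j x → ∀ u r → Homog K (j - degree V u - degree R r) (λ k → slice x u k r)
  slice-Homogᴷ hx u r k ne = hx _ (λ eq → ne (trans (solved (degree V u) (degree K k) (degree R r))
    (cong (λ d → d - degree V u - degree R r) (trans (sym (degree-enc u k r)) eq))))
    where
    solved : ∀ a b c → b ≡ (a + b + c) - a - c
    solved = solve-∀

  slice-Homogᴿ : ∀ {j x} → Homog C j x → ∀ u k → Homog R (j - degree V u - degree K k) (slice x u k)
  slice-Homogᴿ hx u k r ne = hx _ (λ eq → ne (trans (solved (degree V u) (degree K k) (degree R r))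
    (cong (λ d → d - degree V u - degree K k) (trans (sym (degree-enc u k r)) eq))))
    where
    solved : ∀ a b c → c ≡ (a + b + c) - a - b
    solved = solve-∀

  build-Homog : ∀ {j X} → (∀ u r → Homog K (j - degree V u - degree R r) (λ k → X u k r)) → Homog C j (build X)
  build-Homog {j} {X} hX = bySlices (λ s → ¬ (degree C s ≡ j) → build X s ≡ 0ℤ)
    (λ u k r ne → trans (slice-build X u k r) (hX u r k (λ eq → ne (trans (degree-enc u k r)
      (trans (cong (λ d → degree V u + d + degree R r) eq) (solved j (degree V u) (degree R r)))))))
    where
    solved : ∀ j a c → a + (j - a - c) + c ≡ j
    solved = solve-∀

open Decomposition using (slice)

-- In the coordinates of `D` and `D'`, the map `c` is id ⊗ cᴷ ⊗ cᴿ.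
Factorises : ∀ {V C K R C' K' R'} → Decomposition V C K R → Decomposition V C' K' R' →
  Coef C C' → Coef K K' → Coef R R' → Set
Factorises {V} {C} {K} {R} {C'} {K'} {R'} D D' c cᴷ cᴿ = ∀ z u k r →
  slice D' (app C C' c z) u k r ≡ app R R' cᴿ (λ s → app K K' cᴷ (λ k' → slice D z u k' s) k) r

module Factors {R₀ R₁ : FMod} {ρ : Coef R₀ R₁} (S : Split R₀ R₁ ρ)
  (K₀ K₁ K₂ : FMod) (d₀ : Coef K₀ K₁) (d₁ : Coef K₁ K₂) where
  open Split S

  Index : Set
  Index = Fin (rk R₀) ⊎ Fin N

  -- Boundaries lie along the image of `ρ`, so only the image directions are taken modulo boundaries
  -- of `K₀`; complement directions carry plain cycles.
  factor : Index → ℤ → AbGrp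
  factor (inj₁ _) p = SQ K₀ K₁ K₂ d₀ d₁ p
  factor (inj₂ _) p = SQ Zero K₁ K₂ (λ _ _ → 0ℤ) d₁ p

  factor-isAb : ∀ s p → IsAb (factor s p)
  factor-isAb (inj₁ _) p = SQ-isAb K₀ K₁ K₂ d₀ d₁ p
  factor-isAb (inj₂ _) p = SQ-isAb Zero K₁ K₂ (λ _ _ → 0ℤ) d₁ p

  factorDegree : Index → ℤ
  factorDegree (inj₁ s) = degree R₀ s
  factorDegree (inj₂ t) = degree R₁ (κ t)

module _ {V C₀ C₁ C₂ K₀ K₁ K₂ R₀ R₁ R₂ : FMod}
  (D₀ : Decomposition V C₀ K₀ R₀) (D₁ : Decomposition V C₁ K₁ R₁) (D₂ : Decomposition V C₂ K₂ R₂)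
  (c₀ : Coef C₀ C₁) (c₁ : Coef C₁ C₂) (d₀ : Coef K₀ K₁) (d₁ : Coef K₁ K₂) {ρ₀ : Coef R₀ R₁} {ρ₁ : Coef R₁ R₂}
  (S : Split R₀ R₁ ρ₀) (S' : Split R₁ R₂ ρ₁)
  (fac₀ : Factorises D₀ D₁ c₀ d₀ ρ₀) (fac₁ : Factorises D₁ D₂ c₁ d₁ ρ₁) (j : ℤ) where
  private
    module D₀ = Decomposition D₀
    module D₁ = Decomposition D₁
    module D₂ = Decomposition D₂
    module S' = Split S'
    open Split S
    open Factors S K₀ K₁ K₂ d₀ d₁
    δ₀ = app K₀ K₁ d₀
    δ₁ = app K₁ K₂ d₁
    Δ = app R₀ R₁ ρ₀

  private
    target : AbGrp
    target = Π (Fin (rk V) × Index)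
      (λ (u , s) → factor s (j - degree V u - factorDegree s))
    source : AbGrp
    source = SQ C₀ C₁ C₂ c₀ c₁ j

    -- Injectivity of `ρ₁`: reading the differential at the coordinate `S'.ι r` undoes `ρ₁` and
    -- leaves the Khovanov differential of the slice at `r`.
    slice-cycle : ∀ {x} → app C₁ C₂ c₁ x ≋ zeroV → ∀ u r → δ₁ (λ k → D₁.slice x u k r) ≋ zeroV
    slice-cycle {x} cyc u r k = trans (sym (S'.retract _ r))
      (trans (sym (fac₁ x u k (S'.ι r))) (cyc _))

    residueᴷ : El C₁ → Fin (rk V) → Fin N → El K₁
    residueᴷ x u t k = residue (D₁.slice x u k) t

    to : ∣ source ∣ → ∣ target ∣
    to (x , hx , cyc) (u , inj₁ s) =
        (λ k → D₁.slice x u k (ι s))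
      , subst (λ d → Homog K₁ (j - degree V u - d) (λ k → D₁.slice x u k (ι s))) (degree-ι s)
          (D₁.slice-Homogᴷ hx u (ι s))
      , slice-cycle cyc u (ι s)
    to (x , hx , cyc) (u , inj₂ t) =
        residueᴷ x u t
      , (λ k ne → residue-Homog (D₁.slice-Homogᴿ hx u k) t
          (λ eq → ne (trans (solved j (degree V u) (degree K₁ k)) (cong (λ d → j - degree V u - d) (sym eq)))))
      -- The residue is the slice at `κ t` minus `Δ` of the slices at `ι`. All of these are cycles,
      -- and `δ₁` passes through `Δ` by `app-comm`.
      , λ k → trans (app-minus K₁ K₂ d₁ _ _ k) (cong₂ _-_ (slice-cycle cyc u (κ t) k)
          (trans (sym (app-comm R₀ R₁ ρ₀ K₁ K₂ d₁ (λ k → D₁.slice x u k ∘ ι) (κ t) k))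
            (app-≋0 R₀ R₁ ρ₀ (λ s → slice-cycle cyc u (ι s) k) (κ t))))
      where
      solved : ∀ j a b → b ≡ j - a - (j - a - b)
      solved = solve-∀

    -- The summand `Δ` on the `κ`-coordinates offsets what `residue` subtracts, so that `to` returns
    -- the prescribed components.
    from : ∣ target ∣ → Fin (rk V) → Fin (rk K₁) → Fin (rk R₁) → ℤ
    from f u k = glue (λ s → proj₁ (f (u , inj₁ s)) k)
      (λ t → proj₁ (f (u , inj₂ t)) k + Δ (λ s → proj₁ (f (u , inj₁ s)) k) (κ t))

  homology-decomposition : Iso source target
  homology-decomposition = record
    { abˡ = SQ-isAb C₀ C₁ C₂ c₀ c₁ j
    ; abʳ = Π-isAb (λ (u , s) → factor-isAb s _)
    ; to = to
    ; ≈-cong = ≈-cong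
    ; homo = homo
    ; ker = ker
    ; surj = λ f → (D₁.build (from f) , homog f , cycle f) , to-from f }
    where
    ≈-cong : ∀ {x y} → RawGroup._≈_ source x y → RawGroup._≈_ target (to x) (to y)
    ≈-cong {x , _} {y , _} (z , hz , eq) (u , inj₁ s) = (λ k → D₀.slice z u k s) , D₀.slice-Homogᴷ hz u s
      , λ k → trans (eq _) (trans (fac₀ z u k (ι s)) (retract _ s))
    -- Equivalence in a cycle group is plain equality, so the two residues must coincide. They do
    -- because `x - y` has slices in the image of `ρ₀`, which `residue` kills.
    ≈-cong {x , _} {y , _} (z , hz , eq) (u , inj₂ t) = (λ ()) , (λ ()) , λ k →
      trans (sym (residue-minus (D₁.slice x u k) (D₁.slice y u k) t))
        (residue-app (λ s → δ₀ (λ k' → D₀.slice z u k' s) k) (λ r → trans (eq _) (fac₀ z u k r)) t)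

    homo : ∀ x y → RawGroup._≈_ target (to (RawGroup._∙_ source x y)) (RawGroup._∙_ target (to x) (to y))
    homo x y (u , inj₁ s) = IsAbelianGroup.refl (factor-isAb (inj₁ s) _)
      {to (RawGroup._∙_ source x y) (u , inj₁ s)}
    homo x y (u , inj₂ t) = SQ-≋⇒≈ Zero K₁ K₂ (λ _ _ → 0ℤ) d₁ _
      {to (RawGroup._∙_ source x y) (u , inj₂ t)} {RawGroup._∙_ target (to x) (to y) (u , inj₂ t)}
      (λ k → residue-+ (D₁.slice (proj₁ x) u k) (D₁.slice (proj₁ y) u k) t)

    ker : ∀ x → RawGroup._≈_ target (to x) (RawGroup.ε target) → RawGroup._≈_ source x (RawGroup.ε source)
    ker (x , hx , cyc) to≈ε = D₀.build Z , D₀.build-Homog (λ u s → proj₁ (proj₂ (to≈ε (u , inj₁ s))))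
      , D₁.bySlices _ (λ u k r → trans (ℤP.+-identityʳ _)
          (trans (onBasis u k r) (sym (trans (fac₀ (D₀.build Z) u k r)
            (app-cong R₀ R₁ ρ₀ (λ s → app-cong K₀ K₁ d₀ (λ k' → D₀.slice-build Z u k' s) k) r)))))
      where
      -- The primitives of the image components assemble into a primitive of `x`. On the
      -- `κ`-coordinates nothing new is needed, since there the vanishing residue expresses `x`
      -- through its `ι`-coordinates.
      Z : Fin (rk V) → Fin (rk K₀) → Fin (rk R₀) → ℤ
      Z u k s = proj₁ (to≈ε (u , inj₁ s)) k
      bounds : ∀ u k s → D₁.slice x u k (ι s) ≡ δ₀ (λ k' → Z u k' s) k
      bounds u k s = trans (sym (ℤP.+-identityʳ _)) (proj₂ (proj₂ (to≈ε (u , inj₁ s))) k)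
      onBasis : ∀ u k r → D₁.slice x u k r ≡ Δ (λ s → δ₀ (λ k' → Z u k' s) k) r
      onBasis u k = byCases _
        (λ s → trans (bounds u k s) (sym (retract _ s)))
        (λ t → trans
          (residue≡0 {D₁.slice x u k} t (trans (sym (ℤP.+-identityʳ _)) (proj₂ (proj₂ (to≈ε (u , inj₂ t))) k)))
          (app-cong R₀ R₁ ρ₀ (bounds u k) (κ t)))

    homog : ∀ f → Homog C₁ j (D₁.build (from f))
    homog f = D₁.build-Homog {X = from f} λ u → byCases _
      (λ s k ne → trans (glue-ι _ _ s) (proj₁ (proj₂ (f (u , inj₁ s))) k
        (ne ∘ λ eq → trans eq (cong (λ d → j - degree V u - d) (sym (degree-ι s))))))
      (λ t k ne → trans (glue-κ _ _ t) (cong₂ _+_ (proj₁ (proj₂ (f (u , inj₂ t))) k ne)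
        -- For fixed `k`, the K-homogeneity of all the components, read across `s`, becomes
        -- R-homogeneity in the complementary degree, which `ρ₀` preserves.
        (app-Homog {j - degree V u - degree K₁ k}
          (λ s ne' → proj₁ (proj₂ (f (u , inj₁ s))) k (λ eq → ne' (trans
            (exchange j (degree V u) (degree R₀ s)) (cong (λ d → j - degree V u - d) (sym eq)))))
          (κ t) (λ eq → ne (trans
            (exchange j (degree V u) (degree K₁ k)) (cong (λ d → j - degree V u - d) (sym eq)))))))
      where
      exchange : ∀ j a b → b ≡ j - a - (j - a - b)
      exchange = solve-∀

    cycle : ∀ f → app C₁ C₂ c₁ (D₁.build (from f)) ≋ zeroV
    cycle f = D₂.bySlices _ (λ u k r → trans (fac₁ _ u k r)
      (app-≋0 R₁ R₂ ρ₁ (byCases _ (cycle-ι u k) (cycle-κ u k)) r))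
      where
      cycle-ι : ∀ u k s → δ₁ (λ k' → D₁.slice (D₁.build (from f)) u k' (ι s)) k ≡ 0ℤ
      cycle-ι u k s = trans (app-cong K₁ K₂ d₁ (λ k' → trans (D₁.slice-build (from f) u k' (ι s)) (glue-ι _ _ s)) k)
        (proj₂ (proj₂ (f (u , inj₁ s))) k)
      cycle-κ : ∀ u k t → δ₁ (λ k' → D₁.slice (D₁.build (from f)) u k' (κ t)) k ≡ 0ℤ
      cycle-κ u k t = trans (app-cong K₁ K₂ d₁ (λ k' → trans (D₁.slice-build (from f) u k' (κ t)) (glue-κ _ _ t)) k)
        (trans (app-+ K₁ K₂ d₁ _ _ k) (cong₂ _+_ (proj₂ (proj₂ (f (u , inj₂ t))) k)
          (trans (sym (app-comm R₀ R₁ ρ₀ K₁ K₂ d₁ (λ k' s → proj₁ (f (u , inj₁ s)) k') (κ t) k))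
            (app-≋0 R₀ R₁ ρ₀ (λ s → proj₂ (proj₂ (f (u , inj₁ s))) k) (κ t)))))

    to-from : ∀ f → RawGroup._≈_ target (to (D₁.build (from f) , homog f , cycle f)) f
    to-from f (u , inj₁ s) = SQ-≋⇒≈ K₀ K₁ K₂ d₀ d₁ _
      {to (D₁.build (from f) , homog f , cycle f) (u , inj₁ s)} {f (u , inj₁ s)}
      (λ k → trans (D₁.slice-build (from f) u k (ι s)) (glue-ι _ _ s))
    to-from f (u , inj₂ t) = SQ-≋⇒≈ Zero K₁ K₂ (λ _ _ → 0ℤ) d₁ _
      {to (D₁.build (from f) , homog f , cycle f) (u , inj₂ t)} {f (u , inj₂ t)}
      (λ k → trans (cong₂ _-_ (D₁.slice-build (from f) u k (κ t))
          (app-cong R₀ R₁ ρ₀ (λ s → D₁.slice-build (from f) u k (ι s)) (κ t)))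
        (trans (residue-glue _ _ t) (cancel (proj₁ (f (u , inj₂ t)) k) _)))
      where
      cancel : ∀ a b → a + b - b ≡ a
      cancel = solve-∀

-- Matching the two indexings by degree.

module Regrade {U S : Set} (a : U → ℤ) (b : S → ℤ) (G : S → ℤ → AbGrp) (ab : ∀ s p → IsAb (G s p))
  (j : ℤ) (pairs : List (ℤ × ℤ)) (pairs-unique : ∀ m m' → lookup pairs m ≡ lookup pairs m' → m ≡ m')
  (trivial : ∀ s p → ¬ ((p , b s) ∈ pairs) → ∀ g → RawGroup._≈_ (G s p) g (RawGroup.ε (G s p))) where

  private
    module A s p = AbelianGroup (bundle (G s p) (ab s p))
    open DecMembership (ProductP.≡-dec ℤP._≟_ ℤP._≟_) using (_∈?_)

    cast : ∀ s {p p'} → p ≡ p' → ∣ G s p ∣ → ∣ G s p' ∣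
    cast s = subst (λ p → ∣ G s p ∣)

    cast-cong : ∀ s {p p'} (e : p ≡ p') {x y} → A._≈_ s p x y → A._≈_ s p' (cast s e x) (cast s e y)
    cast-cong s refl x≈y = x≈y

    cast-∙ : ∀ s {p p'} (e : p ≡ p') x y → A._≈_ s p' (cast s e (A._∙_ s p x y)) (A._∙_ s p' (cast s e x) (cast s e y))
    cast-∙ s refl x y = A.refl s _

    cast-ker : ∀ s {p p'} (e : p ≡ p') x → A._≈_ s p' (cast s e x) (A.ε s p') → A._≈_ s p x (A.ε s p)
    cast-ker s refl x x≈ε = x≈ε

    cast-cast : ∀ s {p p'} (e : p ≡ p') (e' : p' ≡ p) x → cast s e' (cast s e x) ≡ x
    cast-cast s refl refl x = refl

    remaining : ∀ {x y p q} → x ≡ j - p - q → y ≡ q → j - x - y ≡ p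
    remaining {p = p} {q} refl refl = solved j p q
      where
      solved : ∀ j p q → j - (j - p - q) - q ≡ p
      solved = solve-∀

    first : ∀ {x y p q} → (j - x - y , y) ≡ (p , q) → x ≡ j - p - q
    first {x} {y} refl = solved j x y
      where
      solved : ∀ j x y → x ≡ j - (j - x - y) - y
      solved = solve-∀

    summand : ℤ × ℤ → AbGrp
    summand (p , q) = Π (Σ U (λ u → a u ≡ j - p - q)) (λ _ → Π (Σ S (λ s → b s ≡ q)) (λ (s , _) → G s p))

    -- Outside `pairs` any value would do, as no summand reads it. The membership decision is a
    -- separate argument so that `cast-fetch` can split on it.
    fetch : (∀ m → ∣ summand (lookup pairs m) ∣) → ∀ u s →
      Dec ((j - a u - b s , b s) ∈ pairs) → ∣ G s (j - a u - b s) ∣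
    fetch g u s (no _)  = RawGroup.ε (G s _)
    fetch g u s (yes i) = cast s (sym (remaining (first eq) (cong proj₂ eq)))
                            (g (Any.index i) (u , first eq) (s , cong proj₂ eq))
      where eq = lookup-index i

    cast-fetch : ∀ g m u s (eu : a u ≡ _) (es : b s ≡ _) d →
      cast s (remaining eu es) (fetch g u s d) ≡ g m (u , eu) (s , es)
    cast-fetch g m u s eu es (no ∉) = contradiction
      (subst (_∈ pairs) (sym (cong₂ _,_ (remaining eu es) es)) (∈-lookup m)) ∉
    -- The position found by the membership test is `m` itself because `pairs` has no repetitions;
    -- uniqueness of equality proofs in ℤ then identifies the fibre elements.
    cast-fetch g m u s eu es (yes i)
      with refl ← pairs-unique (Any.index i) m (trans (sym (lookup-index i)) (cong₂ _,_ (remaining eu es) es))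
      = trans (cast-cast s (sym (remaining (first (lookup-index i)) (cong proj₂ (lookup-index i)))) (remaining eu es) _)
          (cong₂ (λ eu es → g (Any.index i) (u , eu) (s , es)) (uip _ _) (uip _ _))

  -- An index (u , s) lies over exactly one pair, namely p = j - a u - b s and q = b s. If this pair
  -- is not listed, its factor is zero by `trivial` and nothing is lost.
  regrade : Iso (Π (U × S) (λ (u , s) → G s (j - a u - b s)))
    (Π (Fin (length pairs)) (summand ∘ lookup pairs))
  regrade = record
    { abˡ = Π-isAb (λ (u , s) → ab s _)
    ; abʳ = Π-isAb (λ m → Π-isAb (λ _ → Π-isAb (λ (s , _) → ab s _)))
    ; to = λ f m (u , eu) (s , es) → cast s (remaining eu es) (f (u , s))
    ; ≈-cong = λ eq m (u , eu) (s , es) → cast-cong s (remaining eu es) (eq (u , s))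
    ; homo = λ x y m (u , eu) (s , es) → cast-∙ s (remaining eu es) _ _
    ; ker = ker
    ; surj = λ g → (λ (u , s) → fetch g u s (_ ∈? pairs))
        , λ m (u , eu) (s , es) → A.reflexive s _ (cast-fetch g m u s eu es (_ ∈? pairs)) }
    where
    ker : ∀ f → _ → ∀ us → _
    ker f eq (u , s) with (j - a u - b s , b s) ∈? pairs
    ... | no ∉  = trivial s _ ∉ _
    ... | yes i = cast-ker s _ _ (eq (Any.index i) (u , first (lookup-index i)) (s , cong proj₂ (lookup-index i)))

-- Enumerations of bases

lookup-injective : {A : Set} {xs : List A} → Unique xs → ∀ i j → lookup xs i ≡ lookup xs j → i ≡ j
lookup-injective (x∉ ∷ u) zero    zero    eq = refl
lookup-injective {xs = _ ∷ xs} (x∉ ∷ u) zero    (suc j) eq = contradiction eq (All.lookup x∉ (∈-lookup j))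
lookup-injective {xs = _ ∷ xs} (x∉ ∷ u) (suc i) zero    eq = contradiction (sym eq) (All.lookup x∉ (∈-lookup i))
lookup-injective (x∉ ∷ u) (suc i) (suc j) eq = cong suc (lookup-injective u i j eq)

-- Two injective labellings with the same set of labels are matched through the labels, which avoids
-- all arithmetic with positions in lists.
matching : {I J A : Set} (f : I → A) (g : J → A) →
  (∀ {i i'} → f i ≡ f i' → i ≡ i') → (∀ {j j'} → g j ≡ g j' → j ≡ j') →
  (∀ i → Σ J λ j → g j ≡ f i) → (∀ j → Σ I λ i → f i ≡ g j) → I ↔ J
matching f g f-inj g-inj h k = mk↔ₛ′ (proj₁ ∘ h) (proj₁ ∘ k)
  (λ j → g-inj (trans (proj₂ (h (proj₁ (k j)))) (proj₂ (k j))))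
  (λ i → f-inj (trans (proj₂ (k (proj₁ (h i)))) (proj₂ (h i))))

index-of : {A : Set} {x : A} {xs : List A} → x ∈ xs → Σ (Fin (length xs)) λ i → lookup xs i ≡ x
index-of x∈xs = Any.index x∈xs , sym (lookup-index x∈xs)

module _ {A B : Set} {f : A → List B} where
  ∈-concatMap : ∀ {xs a b} → a ∈ xs → b ∈ f a → b ∈ concatMap f xs
  ∈-concatMap a∈xs b∈fa = ∈-concatMap⁺ f (lose a∈xs b∈fa)

  concatMap-∀ : {P : B → Set} → ∀ xs → (∀ {a b} → a ∈ xs → b ∈ f a → P b) → ∀ {b} → b ∈ concatMap f xs → P b
  concatMap-∀ xs p b∈ = let (a , a∈xs , b∈fa) = find (∈-concatMap⁻ f {xs = xs} b∈) in p a∈xs b∈fa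

  concatMap-Unique : ∀ {xs} → (∀ a → Unique (f a)) → (∀ {a a' b} → b ∈ f a → b ∈ f a' → a ≡ a') →
    Unique xs → Unique (concatMap f xs)
  concatMap-Unique {[]}     uf disj []        = []
  concatMap-Unique {x ∷ xs} uf disj (x∉ ∷ u) = UniqueP.++⁺ (uf x) (concatMap-Unique uf disj u)
    (λ (b∈fx , b∈rest) → let (a , a∈xs , b∈fa) = find (∈-concatMap⁻ f {xs = xs} b∈rest)
                         in All.lookup x∉ a∈xs (disj b∈fx b∈fa))

map-∀ : {A B : Set} {f : A → B} {P : B → Set} → ∀ xs → (∀ {a} → a ∈ xs → P (f a)) → ∀ {b} → b ∈ map f xs → P b
map-∀ {f = f} {P} xs p b∈ = let (a , a∈xs , eq) = ∈-map⁻ f b∈ in subst P (sym eq) (p a∈xs)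

module _ {A : Set} {xs : List A} where
  allLists-Unique : Unique xs → ∀ n → Unique (allLists n xs)
  allLists-Unique u zero    = All.[] ∷ []
  allLists-Unique u (suc n) = concatMap-Unique
    (λ a → UniqueP.map⁺ ListP.∷-injectiveʳ (allLists-Unique u n))
    (λ p q → let (_ , _ , eq) = ∈-map⁻ _ p ; (_ , _ , eq') = ∈-map⁻ _ q
             in ListP.∷-injectiveˡ (trans (sym eq) eq')) u

  ∈-allLists⁺ : (∀ a → a ∈ xs) → ∀ l → l ∈ allLists (length l) xs
  ∈-allLists⁺ all []      = here refl
  ∈-allLists⁺ all (a ∷ l) = ∈-concatMap (all a) (∈-map⁺ (a ∷_) (∈-allLists⁺ all l))

  ∈-allLists⁻ : ∀ n {l} → l ∈ allLists n xs → length l ≡ n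
  ∈-allLists⁻ zero    (here refl) = refl
  ∈-allLists⁻ (suc n) l∈ = concatMap-∀ xs (λ _ →
    map-∀ {P = λ l → length l ≡ suc n} (allLists n xs) (cong suc ∘ ∈-allLists⁻ n)) l∈

Sgns-Unique : Unique (v₊ ∷ v₋ ∷ [])
Sgns-Unique = ((λ ()) All.∷ All.[]) ∷ All.[] ∷ []

RBs-Unique : Unique (x₀ ∷ x₋₂ ∷ [])
RBs-Unique = ((λ ()) All.∷ All.[]) ∷ All.[] ∷ []

∈-RBs : ∀ a → a ∈ (x₀ ∷ x₋₂ ∷ [])
∈-RBs x₀  = here refl
∈-RBs x₋₂ = there (here refl)

module _ {A : Set} {e : A → A → Bool} (e-refl : ∀ a → e a a ≡ true) (e-sound : ∀ a b → e a b ≡ true → a ≡ b) where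
  eqList-refl : ∀ l → eqList e l l ≡ true
  eqList-refl []      = refl
  eqList-refl (a ∷ l) rewrite e-refl a = eqList-refl l

  eqList-sound : ∀ l l' → eqList e l l' ≡ true → l ≡ l'
  eqList-sound []      []        eq = refl
  eqList-sound (a ∷ l) (a' ∷ l') eq with e a a' in eq'
  ... | true = cong₂ _∷_ (e-sound a a' eq') (eqList-sound l l' eq)

eqS-refl : ∀ a → eqS a a ≡ true
eqS-refl v₊ = refl
eqS-refl v₋ = refl

eqS-sound : ∀ a b → eqS a b ≡ true → a ≡ b
eqS-sound v₊ v₊ eq = refl
eqS-sound v₋ v₋ eq = refl

eqR-refl : ∀ a → eqR a a ≡ true
eqR-refl x₀  = refl
eqR-refl x₋₂ = refl

eqR-sound : ∀ a b → eqR a b ≡ true → a ≡ b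
eqR-sound x₀  x₀  eq = refl
eqR-sound x₋₂ x₋₂ eq = refl

Σℤ-select : ∀ {n} (w x : Fin n → ℤ) t → w t ≡ 1ℤ → (∀ s → ¬ (s ≡ t) → w s ≡ 0ℤ) →
  Σℤ n (λ s → w s * x s) ≡ x t
Σℤ-select {suc n} w x zero wt ws = trans (cong₂ _+_
  (trans (cong (_* x zero) wt) (ℤP.*-identityˡ (x zero)))
  (Σℤ-0 n _ (λ s → cong (_* x (suc s)) (ws (suc s) λ ())))) (ℤP.+-identityʳ _)
Σℤ-select {suc n} w x (suc t) wt ws = trans (cong₂ _+_ (cong (_* x zero) (ws zero λ ()))
  (Σℤ-select (w ∘ suc) (x ∘ suc) t wt (λ s ne → ws (suc s) (ne ∘ FinP.suc-injective)))) (ℤP.+-identityˡ _)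

module _ (M : FMod) (unique : Unique (FMod.enum M)) {e : FMod.B M → FMod.B M → Bool}
  (e-refl : ∀ a → e a a ≡ true) (e-sound : ∀ a b → e a b ≡ true → a ≡ b) where
  -- Since the enumeration has no repetitions, the boolean equality test on basis elements is a
  -- Kronecker delta on positions.
  basis-select : ∀ (x : El M) t → Σℤ (rk M) (λ s → [ e (basis M s) (basis M t) ]ℤ * x s) ≡ x t
  basis-select x t = Σℤ-select _ x t (cong [_]ℤ (e-refl _)) off
    where
    off : ∀ s → ¬ (s ≡ t) → [ e (basis M s) (basis M t) ]ℤ ≡ 0ℤ
    off s s≢t with e (basis M s) (basis M t) in eq
    ... | false = refl
    ... | true  = contradiction (lookup-injective unique s t (e-sound _ _ eq)) s≢t

-- The splitting of Δ̄

-- In the last factor, b ⊗ x₀ occurs in the image of a with coefficient 1 if a = b and 0 otherwise;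
-- all earlier factors are compared by identity. For the empty tensor, 1 goes to x₀. This is the
-- retraction of `Δ̄`.
Δ̄coef-x₀ : ∀ l l' → length l ≡ length l' → Δ̄coef l (l' ∷ʳ x₀) ≡ [ eqList eqR l l' ]ℤ
Δ̄coef-x₀ []          []            len = refl
Δ̄coef-x₀ (x₀  ∷ [])  (x₀  ∷ [])    len = refl
Δ̄coef-x₀ (x₀  ∷ [])  (x₋₂ ∷ [])    len = refl
Δ̄coef-x₀ (x₋₂ ∷ [])  (x₀  ∷ [])    len = refl
Δ̄coef-x₀ (x₋₂ ∷ [])  (x₋₂ ∷ [])    len = refl
Δ̄coef-x₀ (_ ∷ [])    (_ ∷ _ ∷ _)   ()
Δ̄coef-x₀ (a ∷ b ∷ l) (a' ∷ b' ∷ l') len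
  rewrite Δ̄coef-x₀ (b ∷ l) (b' ∷ l') (ℕP.suc-injective len) with eqR a a'
... | true  = ℤP.*-identityˡ _
... | false = refl

Δ̄coef-degree : ∀ l l' → Δ̄coef l l' ≡ 0ℤ ⊎ degRs l ≡ degRs l'
Δ̄coef-degree []          []            = inj₁ refl
Δ̄coef-degree []          (x₀ ∷ [])     = inj₂ refl
Δ̄coef-degree []          (x₋₂ ∷ [])    = inj₁ refl
Δ̄coef-degree []          (_ ∷ _ ∷ _)   = inj₁ refl
Δ̄coef-degree (a ∷ [])    []            = inj₁ refl
Δ̄coef-degree (a ∷ [])    (b ∷ [])      = inj₁ refl
Δ̄coef-degree (x₀ ∷ [])   (x₀ ∷ x₀ ∷ [])   = inj₂ refl
Δ̄coef-degree (x₀ ∷ [])   (x₀ ∷ x₋₂ ∷ [])  = inj₁ refl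
Δ̄coef-degree (x₀ ∷ [])   (x₋₂ ∷ _ ∷ [])   = inj₁ refl
Δ̄coef-degree (x₋₂ ∷ [])  (x₀ ∷ x₀ ∷ [])   = inj₁ refl
Δ̄coef-degree (x₋₂ ∷ [])  (x₀ ∷ x₋₂ ∷ [])  = inj₂ refl
Δ̄coef-degree (x₋₂ ∷ [])  (x₋₂ ∷ x₀ ∷ [])  = inj₂ refl
Δ̄coef-degree (x₋₂ ∷ [])  (x₋₂ ∷ x₋₂ ∷ []) = inj₁ refl
Δ̄coef-degree (a ∷ [])    (b ∷ c ∷ d ∷ l)  = inj₁ refl
Δ̄coef-degree (a ∷ b ∷ l) []            = inj₁ refl
Δ̄coef-degree (a ∷ b ∷ l) (a' ∷ l') with eqR a a' in eq | Δ̄coef-degree (b ∷ l) l'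
... | false | _      = inj₁ refl
... | true  | inj₁ p = inj₁ (cong (1ℤ *_) p)
... | true  | inj₂ p = inj₂ (cong₂ (λ a d → degR a + d) (eqR-sound a a' eq) p)

length-∷ʳ : ∀ {A : Set} (x : A) xs → length (xs ∷ʳ x) ≡ suc (length xs)
length-∷ʳ x xs = trans (ListP.length-++ xs) (ℕP.+-comm (length xs) 1)

sumℤ-∷ʳ : ∀ xs x → sumℤ (xs ∷ʳ x) ≡ sumℤ xs + x
sumℤ-∷ʳ []       x = ℤP.+-comm x 0ℤ
sumℤ-∷ʳ (y ∷ xs) x = trans (cong (_+_ y) (sumℤ-∷ʳ xs x)) (sym (ℤP.+-assoc y _ x))

app-Homog-of-degree : ∀ M₁ M₂ (c : Coef M₁ M₂) → (∀ b b' → c b b' ≡ 0ℤ ⊎ FMod.deg M₁ b ≡ FMod.deg M₂ b') →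
  ∀ {j x} → Homog M₁ j x → Homog M₂ j (app M₁ M₂ c x)
app-Homog-of-degree M₁ M₂ c c-deg {j} {x} hx t ne = Σℤ-0 (rk M₁) _ vanish
  where
  vanish : ∀ s → c (basis M₁ s) (basis M₂ t) * x s ≡ 0ℤ
  vanish s with c-deg (basis M₁ s) (basis M₂ t)
  ... | inj₁ c≡0 = cong (_* x s) c≡0
  ... | inj₂ eq  = trans (cong (c (basis M₁ s) (basis M₂ t) *_) (hx s (ne ∘ trans (sym eq))))
    (ℤP.*-zeroʳ (c (basis M₁ s) (basis M₂ t)))

R⊗-Unique : ∀ n → Unique (FMod.enum (R⊗ n))
R⊗-Unique n = allLists-Unique RBs-Unique n

∈-R⊗ : ∀ n l → length l ≡ n → l ∈ FMod.enum (R⊗ n)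
∈-R⊗ _ l refl = ∈-allLists⁺ ∈-RBs l

length-basis : ∀ n s → length (basis (R⊗ n) s) ≡ n
length-basis n s = ∈-allLists⁻ n (∈-lookup s)

module _ (n : ℕ) where
  private
    I = Fin (rk (R⊗ n))
    r = basis (R⊗ n)
    I⁺ = Fin (rk (R⊗ (suc n)))
    r⁺ = basis (R⊗ (suc n))

    snoc : I ⊎ I → List RB
    snoc (inj₁ s) = r s ∷ʳ x₀
    snoc (inj₂ s) = r s ∷ʳ x₋₂

    snoc-injective : ∀ {s s'} → snoc s ≡ snoc s' → s ≡ s'
    snoc-injective {inj₁ s} {inj₁ s'} eq =
      cong inj₁ (lookup-injective (R⊗-Unique n) s s' (ListP.∷ʳ-injectiveˡ (r s) (r s') eq))
    snoc-injective {inj₂ s} {inj₂ s'} eq =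
      cong inj₂ (lookup-injective (R⊗-Unique n) s s' (ListP.∷ʳ-injectiveˡ (r s) (r s') eq))
    snoc-injective {inj₁ s} {inj₂ s'} eq = contradiction (ListP.∷ʳ-injectiveʳ (r s) (r s') eq) λ ()
    snoc-injective {inj₂ s} {inj₁ s'} eq = contradiction (ListP.∷ʳ-injectiveʳ (r s) (r s') eq) λ ()

    length-snoc : ∀ s → length (snoc s) ≡ suc n
    length-snoc (inj₁ s) = trans (length-∷ʳ x₀ (r s)) (cong suc (length-basis n s))
    length-snoc (inj₂ s) = trans (length-∷ʳ x₋₂ (r s)) (cong suc (length-basis n s))

    unsnoc : ∀ l → length l ≡ suc n → Σ (I ⊎ I) λ s → snoc s ≡ l
    unsnoc l len with initLast l
    ... | l' ∷ʳ′ a with index-of (∈-R⊗ n l' (ℕP.suc-injective (trans (sym (length-∷ʳ a l')) len))) | a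
    ... | i , eq | x₀  = inj₁ i , cong (_∷ʳ x₀) eq
    ... | i , eq | x₋₂ = inj₂ i , cong (_∷ʳ x₋₂) eq

    place : ∀ s → Σ I⁺ λ t → r⁺ t ≡ snoc s
    place s = index-of (∈-R⊗ (suc n) (snoc s) (length-snoc s))

    degree-place : ∀ s → degree (R⊗ (suc n)) (proj₁ (place (inj₁ s))) ≡ degree (R⊗ n) s
    degree-place s = begin
      degRs (r⁺ (proj₁ (place (inj₁ s))))   ≡⟨ cong degRs (proj₂ (place (inj₁ s))) ⟩
      sumℤ (map degR (r s ∷ʳ x₀))           ≡⟨ cong sumℤ (ListP.map-++ degR (r s) (x₀ ∷ [])) ⟩
      sumℤ (map degR (r s) ∷ʳ 0ℤ)           ≡⟨ sumℤ-∷ʳ (map degR (r s)) 0ℤ ⟩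
      degRs (r s) + 0ℤ                      ≡⟨ ℤP.+-identityʳ _ ⟩
      degRs (r s)                           ∎
      where open ≡-Reasoning

    Δ̄coef-place : ∀ s s' → Δ̄coef (r s') (r⁺ (proj₁ (place (inj₁ s)))) ≡ [ eqList eqR (r s') (r s) ]ℤ
    Δ̄coef-place s s' = trans (cong (Δ̄coef (r s')) (proj₂ (place (inj₁ s))))
      (Δ̄coef-x₀ (r s') (r s) (trans (length-basis n s') (sym (length-basis n s))))

  Δ̄-split-suc : Split (R⊗ n) (R⊗ (suc n)) Δ̄coef
  Δ̄-split-suc = record
    { N = rk (R⊗ n)
    ; ι⊎κ = matching snoc r⁺ snoc-injective (λ {t} {t'} → lookup-injective (R⊗-Unique (suc n)) t t')
        place (λ t → unsnoc (r⁺ t) (length-basis (suc n) t))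
    ; degree-ι = degree-place
    ; retract = λ x s → trans
        (Σℤ-cong (rk (R⊗ n)) _ _ (λ s' → cong (_* x s') (Δ̄coef-place s s')))
        (basis-select (R⊗ n) (R⊗-Unique n) (eqList-refl eqR-refl eqR-sound) (eqList-sound eqR-refl eqR-sound) x s)
    ; app-Homog = app-Homog-of-degree (R⊗ n) (R⊗ (suc n)) Δ̄coef Δ̄coef-degree }

-- The coefficient of r ⊗ x₀ in Δ̄ recovers the coefficient of r; the r ⊗ x₋₂ span a complement.
Δ̄-split : ∀ i → Split (R⊗pred i) (R⊗ i) Δ̄coef
Δ̄-split zero = record
  { N = 1
  ; ι⊎κ = mk↔ₛ′ (λ { (inj₁ ()) ; (inj₂ t) → t }) inj₂ (λ _ → refl) (λ { (inj₁ ()) ; (inj₂ _) → refl })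
  ; degree-ι = λ () ; retract = λ _ () ; app-Homog = λ _ _ _ → refl }
Δ̄-split (suc n) = Δ̄-split-suc n

-- Ranges of degrees

∈-range⁺ : ∀ a {n} k → k ℕ.< n → a + + k ∈ range a n
∈-range⁺ a {suc n} zero    k<n = here (ℤP.+-identityʳ a)
∈-range⁺ a {suc n} (suc k) (s≤s k<n) = there (subst (_∈ range (ℤ.suc a) n) (solved a (+ k)) (∈-range⁺ (ℤ.suc a) k k<n))
  where
  solved : ∀ a k → (1ℤ + a) + k ≡ a + (1ℤ + k)
  solved = solve-∀

range-≤ : ∀ a n {b} → b ∈ range a n → a ℤ.≤ b
range-≤ a (suc n) (here refl) = ℤP.≤-refl
range-≤ a (suc n) (there b∈)  = ℤP.≤-trans (ℤP.i≤suc[i] a) (range-≤ (ℤ.suc a) n b∈)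

range-Unique : ∀ a n → Unique (range a n)
range-Unique a zero    = []
range-Unique a (suc n) = All.tabulate (λ b∈ → ℤP.<⇒≢ (ℤP.suc[i]≤j⇒i<j (range-≤ (ℤ.suc a) n b∈)))
  ∷ range-Unique (ℤ.suc a) n

∈-symmetric-range : ∀ D p → ℤ.∣ p ∣ ℕ.≤ D → p ∈ range (- (+ D)) (2 ℕ.* D ℕ.+ 1)
∈-symmetric-range D p ∣p∣≤D with shift-up p ∣p∣≤D
  where
  shift-up : ∀ p → ℤ.∣ p ∣ ℕ.≤ D → Σ ℕ λ k → k ℕ.≤ D ℕ.+ D × (+ k ≡ + D + p)
  shift-up (+ m)    m≤D = D ℕ.+ m , ℕP.+-monoʳ-≤ D m≤D , refl
  shift-up -[1+ m ] m<D = D ℕ.∸ suc m , ℕP.≤-trans (ℕP.m∸n≤m D (suc m)) (ℕP.m≤m+n D D)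
    , sym (ℤP.⊖-≥ m<D)
... | k , k≤ , eq = subst (_∈ range (- (+ D)) (2 ℕ.* D ℕ.+ 1))
  (trans (cong (_+_ (- (+ D))) eq) (solved (+ D) p))
  (∈-range⁺ (- (+ D)) k (ℕP.≤-<-trans k≤ (subst (D ℕ.+ D ℕ.<_) (double D) ℕP.≤-refl)))
  where
  solved : ∀ d p → - d + (d + p) ≡ p
  solved = solve-∀
  double : ∀ d → suc (d ℕ.+ d) ≡ 2 ℕ.* d ℕ.+ 1
  double = ℕ-solve-∀

∣sumℤ∣-bound : {A : Set} (d : A → ℤ) (B : ℕ) → (∀ a → ℤ.∣ d a ∣ ℕ.≤ B) → ∀ l → ℤ.∣ sumℤ (map d l) ∣ ℕ.≤ length l ℕ.* B
∣sumℤ∣-bound d B d≤B []      = z≤n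
∣sumℤ∣-bound d B d≤B (a ∷ l) = ℕP.≤-trans (ℤP.∣i+j∣≤∣i∣+∣j∣ (d a) _) (ℕP.+-mono-≤ (d≤B a) (∣sumℤ∣-bound d B d≤B l))

∣degV∣≤1 : ∀ a → ℤ.∣ degV a ∣ ℕ.≤ 1
∣degV∣≤1 v₊ = ℕP.≤-refl
∣degV∣≤1 v₋ = ℕP.≤-refl

-- The offset `m` is twice the number of factors `x₀`: it measures the degree from the bottom of the
-- range, where all factors are `x₋₂`.
degRs-offset : ∀ l → Σ ℕ λ m → m ℕ.≤ length l ℕ.* 2 × - (+ (length l ℕ.* 2)) + + m ≡ degRs l
degRs-offset []      = 0 , z≤n , refl
degRs-offset (x₀ ∷ l) with degRs-offset l
... | m , m≤ , eq = 2 ℕ.+ m , s≤s (s≤s m≤) , trans (solved (+ (length l ℕ.* 2)) (+ m)) (cong (_+_ 0ℤ) eq)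
  where
  solved : ∀ n m → - (+ 2 + n) + (+ 2 + m) ≡ 0ℤ + (- n + m)
  solved = solve-∀
degRs-offset (x₋₂ ∷ l) with degRs-offset l
... | m , m≤ , eq = m , ℕP.m≤n⇒m≤1+n (ℕP.m≤n⇒m≤1+n m≤)
  , trans (solved (+ (length l ℕ.* 2)) (+ m)) (cong (_+_ (- (+ 2))) eq)
  where
  solved : ∀ n m → - (+ 2 + n) + m ≡ - (+ 2) + (- n + m)
  solved = solve-∀

degree-R⊗∈qRange : ∀ i k → degree (R⊗ i) k ∈ qRange i
degree-R⊗∈qRange i k with degRs-offset (basis (R⊗ i) k)
... | m , m≤ , eq rewrite length-basis i k | ℕP.*-comm i 2 =
  subst (_∈ qRange i) eq (∈-range⁺ (- (+ (2 ℕ.* i))) m (subst (m ℕ.<_) (ℕP.+-comm 1 (2 ℕ.* i)) (s≤s m≤)))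

-- The chromatic complex

Σℤ≡sum : ∀ n f → Σℤ n f ≡ MonoidSum.sum ℤP.+-0-commutativeMonoid f
Σℤ≡sum zero    f = refl
Σℤ≡sum (suc n) f = cong (_+_ (f zero)) (Σℤ≡sum n (f ∘ suc))

Σℤ-reindex : ∀ {m n} → (π : Fin m ↔ Fin n) → ∀ f → Σℤ n f ≡ Σℤ m (f ∘ Inverse.to π)
Σℤ-reindex {m} {n} π f = trans (Σℤ≡sum n f)
  (trans (MonoidSum.sum-permute ℤP.+-0-commutativeMonoid f π) (sym (Σℤ≡sum m _)))

Σℤ-++ : ∀ m n f → Σℤ (m ℕ.+ n) f ≡ Σℤ m (λ i → f (i ↑ˡ n)) + Σℤ n (λ j → f (m ↑ʳ j))
Σℤ-++ zero    n f = sym (ℤP.+-identityˡ _)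
Σℤ-++ (suc m) n f = trans (cong (_+_ (f zero)) (Σℤ-++ m n (f ∘ suc))) (sym (ℤP.+-assoc (f zero) _ _))

Σℤ-combine : ∀ m n f → Σℤ (m ℕ.* n) f ≡ Σℤ m (λ i → Σℤ n (λ j → f (combine i j)))
Σℤ-combine zero    n f = refl
Σℤ-combine (suc m) n f = trans (Σℤ-++ n (m ℕ.* n) f) (cong (_+_ (Σℤ n _)) (Σℤ-combine m n (λ k → f (n ↑ʳ k))))

Σℤ-pairs : ∀ {m n} (f : Fin m × Fin n → ℤ) →
  Σℤ (m ℕ.* n) (f ∘ remQuot n) ≡ Σℤ m (λ i → Σℤ n (λ j → f (i , j)))
Σℤ-pairs {m} {n} f = trans (Σℤ-combine m n _) (Σℤ-cong m _ _ λ i → Σℤ-cong n _ _ λ j →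
  cong f (FinP.remQuot-combine i j))

Σℤ-triples : ∀ {l m n k} (e : (Fin l × Fin m × Fin n) ↔ Fin k) f →
  Σℤ k f ≡ Σℤ l (λ u → Σℤ m (λ v → Σℤ n (λ w → f (Inverse.to e (u , v , w)))))
Σℤ-triples {l} {m} {n} e f = begin
  Σℤ _ f                                             ≡⟨ Σℤ-reindex (e ↔-∘ ((↔-id _ ×-↔ FinP.*↔×) ↔-∘ FinP.*↔×)) f ⟩
  Σℤ (l ℕ.* (m ℕ.* n)) (g ∘ remQuot (m ℕ.* n))       ≡⟨ Σℤ-pairs g ⟩
  Σℤ l (λ u → Σℤ (m ℕ.* n) (λ t → g (u , t)))
    ≡⟨ Σℤ-cong l _ _ (λ u → Σℤ-pairs (λ vw → f (Inverse.to e (u , vw)))) ⟩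
  Σℤ l (λ u → Σℤ m (λ v → Σℤ n (λ w → f (Inverse.to e (u , v , w)))))  ∎
  where
  open ≡-Reasoning
  g : Fin l × Fin (m ℕ.* n) → ℤ
  g (u , t) = f (Inverse.to e (u , remQuot n t))

[∧]ℤ : ∀ a b → [ a ∧ b ]ℤ ≡ [ a ]ℤ * [ b ]ℤ
[∧]ℤ true  b = sym (ℤP.*-identityˡ _)
[∧]ℤ false b = refl

length-filterᵇ : {A : Set} (p : A → Bool) (xs : List A) → count p xs ℕ.≤ length xs
length-filterᵇ p xs = ListP.length-filter (T? ∘ p) xs

module Chromatic (F : Fatgraph) where
  open FG F hiding (ι)

  comb : List Sgn → KhB → List RB → ChB
  comb vs (α , zs , ss) rs = α , vs , zs , ss , rs

  -- The sign and the boundary-component map depend only on the Khovanov data, and the joint test on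
  -- `vs` and `zs` is a product of two tests. Hence the coefficient is that of id ⊗ d ⊗ Δ̄.
  coefCh-comb : ∀ vs κ rs vs' κ' rs' → coefCh (comb vs κ rs) (comb vs' κ' rs')
    ≡ [ eqList eqS vs vs' ]ℤ * (coefKh κ κ' * Δ̄coef rs rs')
  coefCh-comb vs (α , zs , ss) rs vs' (α' , zs' , ss') rs' with oneMore α α'
  ... | nothing = sym (ℤP.*-zeroʳ [ eqList eqS vs vs' ]ℤ)
  ... | just j  = trans
    (cong (λ e → pm (count id (take j α)) * e * bcoef α α' ss ss' * Δ̄coef rs rs')
      ([∧]ℤ (eqList eqS vs vs') (eqList eqS zs zs')))
    (solved (pm (count id (take j α))) [ eqList eqS vs vs' ]ℤ [ eqList eqS zs zs' ]ℤ
      (bcoef α α' ss ss') (Δ̄coef rs rs'))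
    where
    solved : ∀ p e e' b d → p * (e * e') * b * d ≡ e * (p * e' * b * d)
    solved = solve-∀

  -- The list `rss` is a parameter because cohomological degree -1 also occurs; there it must be
  -- empty, in agreement with `predEnum zero`.
  record EnumeratesTriples (a : ℤ) (rss : List (List RB)) : Set where
    field
      uniqueC : Unique (enumCh a)
      uniqueK : Unique (enumKh a)
      uniqueR : Unique rss
      member⁺ : ∀ {vs κ rs} → vs ∈ allLists nv Sgns → κ ∈ enumKh a → rs ∈ rss → comb vs κ rs ∈ enumCh a
      member⁻ : ∀ {vs κ rs} → comb vs κ rs ∈ enumCh a → vs ∈ allLists nv Sgns × κ ∈ enumKh a × rs ∈ rss

  V : FMod
  V = V⊗ nv

  V-Unique : Unique (FMod.enum V)
  V-Unique = allLists-Unique Sgns-Unique nv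

  module CochainBasis {a : ℤ} {rss : List (List RB)} (E : EnumeratesTriples a rss) where
    open EnumeratesTriples E
    C K R : FMod
    C = Lvl C̃F a
    K = Lvl C̃L a
    R = record { B = List RB ; enum = rss ; deg = degRs }

    private
      combBasis : Fin (rk V) × Fin (rk K) × Fin (rk R) → ChB
      combBasis (u , k , r) = comb (basis V u) (basis K k) (basis R r)

      combBasis-injective : ∀ {t t'} → combBasis t ≡ combBasis t' → t ≡ t'
      combBasis-injective {u , k , r} {u' , k' , r'} eq = cong₂ _,_
        (lookup-injective V-Unique u u' (cong (proj₁ ∘ proj₂) eq))
        (cong₂ _,_ (lookup-injective uniqueK k k' (cong (λ (α , _ , zs , ss , _) → α , zs , ss) eq))
                   (lookup-injective uniqueR r r' (cong (λ (_ , _ , _ , _ , rs) → rs) eq)))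

      enc⁺ : ∀ t → Σ (Fin (rk C)) λ s → basis C s ≡ combBasis t
      enc⁺ (u , k , r) = index-of (member⁺ (∈-lookup u) (∈-lookup k) (∈-lookup r))

      dec⁺ : ∀ s → Σ (Fin (rk V) × Fin (rk K) × Fin (rk R)) λ t → combBasis t ≡ basis C s
      dec⁺ s =
        let (v∈ , κ∈ , r∈) = member⁻ {proj₁ (proj₂ (basis C s))} {_ , _ , _} {_} (∈-lookup s)
            (u , equ) = index-of v∈
            (k , eqk) = index-of κ∈
            (r , eqr) = index-of r∈
        in (u , k , r) , trans (cong₂ (λ v κ → comb v κ (basis R r)) equ eqk) (cong (comb _ _) eqr)

    basis-enc : ∀ t → basis C (proj₁ (enc⁺ t)) ≡ combBasis t
    basis-enc t = proj₂ (enc⁺ t)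

    decomposition : Decomposition V C K R
    decomposition = record
      { triple = matching combBasis (basis C) combBasis-injective (λ {s} {s'} → lookup-injective uniqueC s s') enc⁺ dec⁺
      ; degree-enc = λ u k r → trans (cong degCh (basis-enc (u , k , r)))
          (degCh-comb (basis V u) (basis K k) (basis R r)) }
      where
      solved : ∀ v z s r h → v + z + s + r + h ≡ v + (z + s + h) + r
      solved = solve-∀
      degCh-comb : ∀ vs κ rs → degCh (comb vs κ rs) ≡ degVs vs + degKh κ + degRs rs
      degCh-comb vs (α , zs , ss) rs = solved (degVs vs) (degVs zs) (degVs ss) (degRs rs) (+ height α)

  module _ {a a' : ℤ} {rss rss' : List (List RB)} (E : EnumeratesTriples a rss) (E' : EnumeratesTriples a' rss') where
    private
      module L  = CochainBasis E
      module L' = CochainBasis E'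
      D  = L.decomposition
      D' = L'.decomposition
      open Decomposition using (enc)

    factorises : Factorises D D' coefCh coefKh Δ̄coef
    factorises z u k r = begin
      app L.C L'.C coefCh z (enc D' (u , k , r))
        ≡⟨ Σℤ-triples (Decomposition.triple D) _ ⟩
      Σℤ nV (λ u' → Σℤ nK (λ k' → Σℤ nR (λ r' →
          coefCh (basis L.C (enc D (u' , k' , r'))) (basis L'.C (enc D' (u , k , r))) * Z u' k' r')))
        ≡⟨ Σℤ-cong nV _ _ (λ u' → Σℤ-cong nK _ _ λ k' → Σℤ-cong nR _ _ λ r' →
            cong (_* Z u' k' r') (coef-enc u' k' r')) ⟩
      Σℤ nV (λ u' → Σℤ nK (λ k' → Σℤ nR (λ r' → w u' * (d k' * ρ r') * Z u' k' r')))
        ≡⟨ Σℤ-cong nV _ _ pull ⟩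
      Σℤ nV (λ u' → w u' * Σℤ nR (λ r' → ρ r' * Σℤ nK (λ k' → d k' * Z u' k' r')))
        ≡⟨ basis-select V V-Unique (eqList-refl eqS-refl eqS-sound) (eqList-sound eqS-refl eqS-sound) _ u ⟩
      Σℤ nR (λ r' → ρ r' * Σℤ nK (λ k' → d k' * Z u k' r'))
        ∎
      where
      open ≡-Reasoning
      nV = rk V
      nK = rk L.K
      nR = rk L.R
      Z : Fin nV → Fin nK → Fin nR → ℤ
      Z = slice D z
      w : Fin nV → ℤ
      w u' = [ eqList eqS (basis V u') (basis V u) ]ℤ
      d : Fin nK → ℤ
      d k' = coefKh (basis L.K k') (basis L'.K k)
      ρ : Fin nR → ℤ
      ρ r' = Δ̄coef (basis L.R r') (basis L'.R r)
      coef-enc : ∀ u' k' r' → coefCh (basis L.C (enc D (u' , k' , r'))) (basis L'.C (enc D' (u , k , r)))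
        ≡ w u' * (d k' * ρ r')
      coef-enc u' k' r' = trans (cong₂ coefCh (L.basis-enc (u' , k' , r')) (L'.basis-enc (u , k , r)))
        (coefCh-comb (basis V u') (basis L.K k') (basis L.R r') (basis V u) (basis L'.K k) (basis L'.R r))
      rearrange : ∀ w d ρ z → w * (d * ρ) * z ≡ w * (ρ * (d * z))
      rearrange = solve-∀
      pull : ∀ u' → Σℤ nK (λ k' → Σℤ nR (λ r' → w u' * (d k' * ρ r') * Z u' k' r'))
        ≡ w u' * Σℤ nR (λ r' → ρ r' * Σℤ nK (λ k' → d k' * Z u' k' r'))
      pull u' = begin
        Σℤ nK (λ k' → Σℤ nR (λ r' → w u' * (d k' * ρ r') * Z u' k' r'))
          ≡⟨ Σℤ-swap nK nR _ ⟩
        Σℤ nR (λ r' → Σℤ nK (λ k' → w u' * (d k' * ρ r') * Z u' k' r'))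
          ≡⟨ Σℤ-cong nR _ _ (λ r' → Σℤ-cong nK _ _ λ k' → rearrange (w u') (d k') (ρ r') (Z u' k' r')) ⟩
        Σℤ nR (λ r' → Σℤ nK (λ k' → w u' * (ρ r' * (d k' * Z u' k' r'))))
          ≡⟨ Σℤ-cong nR _ _ (λ r' → trans (sym (Σℤ-*ˡ nK (w u') _)) (cong (w u' *_) (sym (Σℤ-*ˡ nK (ρ r') _)))) ⟩
        Σℤ nR (λ r' → w u' * (ρ r' * Σℤ nK (λ k' → d k' * Z u' k' r')))
          ≡⟨ Σℤ-*ˡ nR (w u') _ ⟨
        w u' * Σℤ nR (λ r' → ρ r' * Σℤ nK (λ k' → d k' * Z u' k' r'))
          ∎

  module _ (i : ℕ) where
    private
      Ss : ℕ → List (List Sgn)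
      Ss n = allLists n Sgns
      Ss-Unique : ∀ n → Unique (Ss n)
      Ss-Unique = allLists-Unique Sgns-Unique

    states-Unique : Unique (states i)
    states-Unique = UniqueP.filter⁺ (T? ∘ λ α → count id α ℕ.≡ᵇ i)
      (allLists-Unique (((λ ()) All.∷ All.[]) ∷ All.[] ∷ []) ne)

    private
      chS : State → List Sgn → List Sgn → List Sgn → List ChB
      chS α vs zs ss = map (λ rs → α , vs , zs , ss , rs) (allLists i RBs)
      chZ : State → List Sgn → List Sgn → List ChB
      chZ α vs zs = concatMap (chS α vs zs) (Ss (nOrb α))
      chV : State → List Sgn → List ChB
      chV α vs = concatMap (chZ α vs) (Ss nIso)
      chα : State → List ChB
      chα α = concatMap (chV α) (Ss nv)

      khZ : State → List Sgn → List KhB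
      khZ α zs = map (λ ss → α , zs , ss) (Ss (nOrb α))
      khα : State → List KhB
      khα α = concatMap (khZ α) (Ss nIso)

    member-Kh⁻ : ∀ {κ} → κ ∈ enumKh (+ i) →
      let (α , zs , ss) = κ in α ∈ states i × zs ∈ Ss nIso × ss ∈ Ss (nOrb α)
    member-Kh⁻ = concatMap-∀ (states i) λ {α} α∈ → concatMap-∀ (Ss nIso) λ zs∈ →
      map-∀ {P = λ (α , zs , ss) → α ∈ states i × zs ∈ Ss nIso × ss ∈ Ss (nOrb α)} (Ss (nOrb α)) λ ss∈ → α∈ , zs∈ , ss∈

    member-Kh⁺ : ∀ {α zs ss} → α ∈ states i → zs ∈ Ss nIso → ss ∈ Ss (nOrb α) → (α , zs , ss) ∈ enumKh (+ i)
    member-Kh⁺ {α} {zs} α∈ zs∈ ss∈ = ∈-concatMap {f = khα} α∈ (∈-concatMap {f = khZ α} zs∈ (∈-map⁺ _ ss∈))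

    enumerates : EnumeratesTriples (+ i) (allLists i RBs)
    enumerates = record
      { uniqueC = concatMap-Unique
          (λ α → concatMap-Unique
            (λ vs → concatMap-Unique
              (λ zs → concatMap-Unique
                (λ ss → UniqueP.map⁺ (cong (λ (_ , _ , _ , _ , rs) → rs)) (R⊗-Unique i))
                (λ p q → trans (sym (tagS α vs zs p)) (tagS α vs zs q)) (Ss-Unique (nOrb α)))
              (λ p q → trans (sym (tagZ α vs p)) (tagZ α vs q)) (Ss-Unique nIso))
            (λ p q → trans (sym (tagV α p)) (tagV α q)) (Ss-Unique nv))
          (λ p q → trans (sym (tagα p)) (tagα q)) states-Unique
      ; uniqueK = concatMap-Unique
          (λ α → concatMap-Unique
            (λ zs → UniqueP.map⁺ (cong (proj₂ ∘ proj₂)) (Ss-Unique (nOrb α)))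
            (λ p q → trans (sym (tagKZ α p)) (tagKZ α q)) (Ss-Unique nIso))
          (λ p q → trans (sym (tagKα p)) (tagKα q)) states-Unique
      ; uniqueR = R⊗-Unique i
      ; member⁺ = λ {vs} {(α , zs , ss)} vs∈ κ∈ rs∈ → let (α∈ , zs∈ , ss∈) = member-Kh⁻ κ∈ in
          ∈-concatMap {f = chα} α∈ (∈-concatMap {f = chV α} vs∈ (∈-concatMap {f = chZ α vs} zs∈
            (∈-concatMap {f = chS α vs zs} ss∈ (∈-map⁺ _ rs∈))))
      ; member⁻ = member⁻ }
      where
      -- Each block of a `concatMap` records its own label in a component of its elements. Blocks
      -- with a common element therefore have equal labels, which is the disjointness that
      -- `concatMap-Unique` asks for.
      tagS : ∀ α vs zs {ss b} → b ∈ chS α vs zs ss → proj₁ (proj₂ (proj₂ (proj₂ b))) ≡ ss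
      tagS α vs zs {ss} = map-∀ {P = λ b → proj₁ (proj₂ (proj₂ (proj₂ b))) ≡ ss} (allLists i RBs) λ _ → refl
      tagZ : ∀ α vs {zs b} → b ∈ chZ α vs zs → proj₁ (proj₂ (proj₂ b)) ≡ zs
      tagZ α vs {zs} = concatMap-∀ (Ss (nOrb α)) λ _ →
        map-∀ {P = λ b → proj₁ (proj₂ (proj₂ b)) ≡ zs} (allLists i RBs) λ _ → refl
      tagV : ∀ α {vs b} → b ∈ chV α vs → proj₁ (proj₂ b) ≡ vs
      tagV α {vs} = concatMap-∀ (Ss nIso) λ _ → concatMap-∀ (Ss (nOrb α)) λ _ →
        map-∀ {P = λ b → proj₁ (proj₂ b) ≡ vs} (allLists i RBs) λ _ → refl
      tagα : ∀ {α b} → b ∈ chα α → proj₁ b ≡ α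
      tagα {α} = concatMap-∀ (Ss nv) λ _ → concatMap-∀ (Ss nIso) λ _ → concatMap-∀ (Ss (nOrb α)) λ _ →
        map-∀ {P = λ b → proj₁ b ≡ α} (allLists i RBs) λ _ → refl
      tagKZ : ∀ α {zs b} → b ∈ khZ α zs → proj₁ (proj₂ b) ≡ zs
      tagKZ α {zs} = map-∀ {P = λ b → proj₁ (proj₂ b) ≡ zs} (Ss (nOrb α)) λ _ → refl
      tagKα : ∀ {α b} → b ∈ khα α → proj₁ b ≡ α
      tagKα {α} = concatMap-∀ (Ss nIso) λ _ → map-∀ {P = λ b → proj₁ b ≡ α} (Ss (nOrb α)) λ _ → refl

      P : ChB → Set
      P (α , vs , zs , ss , rs) = vs ∈ Ss nv × (α , zs , ss) ∈ enumKh (+ i) × rs ∈ allLists i RBs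
      member⁻ : ∀ {vs κ rs} → comb vs κ rs ∈ enumCh (+ i) → vs ∈ Ss nv × κ ∈ enumKh (+ i) × rs ∈ allLists i RBs
      member⁻ = concatMap-∀ {P = P} (states i) λ {α} α∈ → concatMap-∀ (Ss nv) λ vs∈ → concatMap-∀ (Ss nIso) λ zs∈ →
        concatMap-∀ (Ss (nOrb α)) λ ss∈ → map-∀ {P = P} (allLists i RBs) λ rs∈ → vs∈ , member-Kh⁺ α∈ zs∈ ss∈ , rs∈

  enumeratesPred : ∀ i → EnumeratesTriples (ℤ.pred (+ i)) (predEnum i)
  -- In cohomological degree -1 the chromatic, Khovanov and R-enumerations are all empty.
  enumeratesPred zero    = record { uniqueC = [] ; uniqueK = [] ; uniqueR = [] ; member⁺ = λ _ () ; member⁻ = λ () }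
  enumeratesPred (suc i) = enumerates i

  -- There are at most `nv` factors from isolated vertices, at most one boundary factor for each of
  -- the `ne ℕ.+ ne` half-edges, and the height is at most `ne`; `degBound` leaves 1 to spare.
  ∣degKh∣-bound : ∀ i {κ} → κ ∈ enumKh (+ i) → ℤ.∣ degKh κ ∣ ℕ.≤ degBound
  ∣degKh∣-bound i {α , zs , ss} κ∈ = begin
    ℤ.∣ degVs zs + degVs ss + + height α ∣                  ≤⟨ ℤP.∣i+j∣≤∣i∣+∣j∣ (degVs zs + degVs ss) _ ⟩
    ℤ.∣ degVs zs + degVs ss ∣ ℕ.+ height α                  ≤⟨ ℕP.+-monoˡ-≤ _ (ℤP.∣i+j∣≤∣i∣+∣j∣ (degVs zs) _) ⟩
    ℤ.∣ degVs zs ∣ ℕ.+ ℤ.∣ degVs ss ∣ ℕ.+ height α          ≤⟨ ℕP.+-mono-≤ (ℕP.+-mono-≤ zs-bound ss-bound) α-bound ⟩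
    nv ℕ.+ (ne ℕ.+ ne) ℕ.+ ne                               ≤⟨ ℕP.m≤m+n _ 1 ⟩
    nv ℕ.+ (ne ℕ.+ ne) ℕ.+ ne ℕ.+ 1                         ≡⟨ regroup nv ne ⟩
    degBound                                                ∎
    where
    open ℕP.≤-Reasoning
    regroup : ∀ v e → v ℕ.+ (e ℕ.+ e) ℕ.+ e ℕ.+ 1 ≡ 3 ℕ.* e ℕ.+ v ℕ.+ 1
    regroup = ℕ-solve-∀
    member = member-Kh⁻ i κ∈
    length-allFin : ∀ n → length (allFin n) ≡ n
    length-allFin n = ListP.length-tabulate id
    degVs-bound : ∀ {n l} → l ∈ allLists n Sgns → ℤ.∣ degVs l ∣ ℕ.≤ n
    degVs-bound {n} {l} l∈ = subst (ℤ.∣ degVs l ∣ ℕ.≤_) (trans (ℕP.*-identityʳ _) (∈-allLists⁻ n l∈))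
      (∣sumℤ∣-bound degV 1 ∣degV∣≤1 l)
    zs-bound : ℤ.∣ degVs zs ∣ ℕ.≤ nv
    zs-bound = ℕP.≤-trans (degVs-bound (proj₁ (proj₂ member)))
      (subst (nIso ℕ.≤_) (length-allFin nv) (length-filterᵇ _ (allFin nv)))
    ss-bound : ℤ.∣ degVs ss ∣ ℕ.≤ ne ℕ.+ ne
    ss-bound = ℕP.≤-trans (degVs-bound (proj₂ (proj₂ member)))
      (subst (nOrb α ℕ.≤_) (length-allFin (ne ℕ.+ ne)) (length-filterᵇ (isRep α) darts))
    α-bound : height α ℕ.≤ ne
    α-bound = subst (height α ℕ.≤_) (∈-allLists⁻ ne (proj₁ (∈-filter⁻ (T? ∘ λ α → count id α ℕ.≡ᵇ i) (proj₁ member))))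
      (length-filterᵇ id α)

  -- Assembly of the isomorphism.

  module _ (i : ℕ) (j : ℤ) where
    private
      K₀ = Lvl C̃L (ℤ.pred (+ i))
      K₁ = Lvl C̃L (+ i)
      K₂ = Lvl C̃L (+ suc i)
      module S = Split (Δ̄-split i)
      open Factors (Δ̄-split i) K₀ K₁ K₂ coefKh coefKh
      E₀ = enumeratesPred i
      E₁ = enumerates i
      E₂ = enumerates (suc i)
      pairs = cartesianProduct pRange (qRange i)

      pairs-Unique : Unique pairs
      pairs-Unique = UniqueP.cartesianProduct⁺ {xs = pRange} {ys = qRange i} (range-Unique _ _) (range-Unique _ _)

      HK Z : ℤ → AbGrp
      HK p = Hom C̃L (+ i) p
      Z p  = Cyc C̃L (+ i) p
      HK-isAb : ∀ p → IsAb (HK p)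
      HK-isAb = SQ-isAb K₀ K₁ K₂ coefKh coefKh
      Z-isAb : ∀ p → IsAb (Z p)
      Z-isAb = SQ-isAb Zero K₁ K₂ (λ _ _ → 0ℤ) coefKh

      factorDegree∈qRange : ∀ s → factorDegree s ∈ qRange i
      factorDegree∈qRange (inj₁ s) = subst (_∈ qRange i) (S.degree-ι s) (degree-R⊗∈qRange i (S.ι s))
      factorDegree∈qRange (inj₂ t) = degree-R⊗∈qRange i (S.κ t)

      SQ-trivial : ∀ M₀ (c : Coef M₀ K₁) p → ¬ (p ∈ pRange) → ∀ x →
        let G = SQ M₀ K₁ K₂ c coefKh p in RawGroup._≈_ G x (RawGroup.ε G)
      SQ-trivial M₀ c p p∉ x = SQ-≋⇒≈ M₀ K₁ K₂ c coefKh p {x} {RawGroup.ε (SQ M₀ K₁ K₂ c coefKh p)}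
        (λ k → proj₁ (proj₂ x) k (λ eq → p∉ (subst (_∈ pRange) eq
          (∈-symmetric-range degBound (degree K₁ k) (∣degKh∣-bound i (∈-lookup k))))))

      factor-trivial : ∀ s p → ¬ ((p , factorDegree s) ∈ pairs) → ∀ x →
        RawGroup._≈_ (factor s p) x (RawGroup.ε (factor s p))
      factor-trivial s p ∉ x = trivialAt s x
        where
        -- The R-degree always lies in `qRange i`, so only the Khovanov degree can put a pair
        -- outside the window.
        p∉ : ¬ (p ∈ pRange)
        p∉ p∈ = ∉ (∈-cartesianProduct⁺ p∈ (factorDegree∈qRange s))
        trivialAt : ∀ s x → RawGroup._≈_ (factor s p) x (RawGroup.ε (factor s p))
        trivialAt (inj₁ _) x = SQ-trivial K₀ coefKh p p∉ x
        trivialAt (inj₂ _) x = SQ-trivial Zero (λ _ _ → 0ℤ) p p∉ x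

      inner : ∀ p q → Iso ((HK p ⊗ ImΔ̄ i q) ⊕ (Z p ⊗ CokΔ̄ i q))
        (Π (Σ Index (λ s → factorDegree s ≡ q)) (λ (s , _) → factor s p))
      inner p q = Iso-trans
        (⊕-cong (⊗-free-fibre (degree (R⊗pred i)) q (HK-isAb p) (S.Img-free q))
                (⊗-free-fibre (degree (R⊗ i) ∘ S.κ) q (Z-isAb p) (S.Coker-free q)))
        (Π-⊎ {P = λ s → factorDegree s ≡ q} {G = λ s → factor s p} (λ s → factor-isAb s p))

      summand : ∀ p q → Iso (((HK p ⊗ ImΔ̄ i q) ⊕ (Z p ⊗ CokΔ̄ i q)) ⊗ V⊗deg nv (j - p - q))
        (Π (Σ (Fin (rk V)) (λ u → degree V u ≡ j - p - q))
          (λ _ → Π (Σ Index (λ s → factorDegree s ≡ q)) (λ (s , _) → factor s p)))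
      summand p q = Iso-trans
        (⊗-free-fibre (degree V) (j - p - q) (Iso.abˡ (inner p q)) (Split.Coker-free (Zero-split V) (j - p - q)))
        (Π-cong (λ _ → inner p q))

    -- The two sides meet in a product over the pairs (p , q): the left side by
    -- `homology-decomposition` and `regrade`, the right side by replacing every tensor product with
    -- a finite power.
    homology≅RHS : Iso (Hom C̃F (+ i) j) (RHS F i j)
    homology≅RHS = Iso-trans
      (homology-decomposition
        (CochainBasis.decomposition E₀) (CochainBasis.decomposition E₁) (CochainBasis.decomposition E₂)
        coefCh coefCh coefKh coefKh (Δ̄-split i) (Δ̄-split (suc i)) (factorises E₀ E₁) (factorises E₁ E₂) j)
      (Iso-trans
        (Regrade.regrade (degree V) factorDegree factor factor-isAb j pairs
          (lookup-injective pairs-Unique) factor-trivial)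
        (Iso-sym (Iso-trans
          (⨁≅Π pairs (λ (p , q) → Iso.abˡ (summand p q)))
          (Π-cong (λ m → let (p , q) = lookup pairs m in summand p q)))))

  -- Both groups are the same subquotient of `C̃F`, up to integer identities in its three indices,
  -- so the identity is transported along them.
  shift-homology : ∀ i j → Iso (Hom CF i j) (Hom C̃F (i + + ne) j)
  shift-homology i j = subst (Iso (Hom CF i j))
    (trans
      (cong (λ a → SQ (Lvl C̃F a) (Lvl C̃F (i - - (+ ne))) (Lvl C̃F (ℤ.suc i - - (+ ne))) coefCh coefCh j)
        (reassoc -1ℤ))
      (cong₂ (λ a b → SQ (Lvl C̃F (ℤ.pred (i + + ne))) (Lvl C̃F a) (Lvl C̃F b) coefCh coefCh j)
        (cong (_+_ i) (ℤP.neg-involutive (+ ne))) (reassoc 1ℤ)))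
    (Iso-refl (SQ-isAb (Lvl CF (ℤ.pred i)) (Lvl CF i) (Lvl CF (ℤ.suc i)) coefCh coefCh j))
    where
    reassoc : ∀ a → (a + i) - - (+ ne) ≡ a + (i + + ne)
    reassoc a = trans (ℤP.+-assoc a i _) (cong (λ n → a + (i + n)) (ℤP.neg-involutive (+ ne)))

theorem6p2 : (F : Fatgraph) → FG.Genus0 F →
    ((i : ℕ) (j : ℤ) → Hom (FG.C̃F F) (+ i) j ≅ RHS F i j)
    × ((i j : ℤ) → Hom (FG.CF F) i j ≅ Hom (FG.C̃F F) (i + + Fatgraph.ne F) j)
theorem6p2 F _ =
    (λ i j → Iso⇒≅ (Chromatic.homology≅RHS F i j))
  , (λ i j → Iso⇒≅ (Chromatic.shift-homology F i j))
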